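{- Let $q$ be a prime power and let $k, d$ be fixed integers with $k \geq d+1 \geq 3$. Suppose $\mathcal{V}$ is a family of $k$-dimensional subspaces of $\mathbb{F}_q^n$ containing no $d$-simplex-cluster. Then for $n$ sufficiently large, \[|\mathcal{V}| < q^{n-k}\genfrac{[}{]}{0pt}{}{n-1}{k-1} = \genfrac{[}{]}{0pt}{}{n}{k} - \genfrac{[}{]}{0pt}{}{n-1}{k}.\]
   Context: $\genfrac{[}{]}{0pt}{}{n}{k} = \prod_{0 \leq i \leq k-1}\frac{q^{n-i}-1}{q^{k-i}-1}$. A family $\{A_1, \dots, A_{d+1}\}$ of $k$-dimensional subspaces of $\mathbb{F}_q^n$ is a $d$-simplex if $\dim(\bigcap_{i=1}^{d+1} A_i) = 0$ but $\dim(A_{i_1} \cap \cdots \cap A_{i_d}) > 0$ for any $d$ distinct members $A_{i_1}, \dots, A_{i_d}$; it is a $d$-cluster if $\dim(\bigcap_{i=1}^{d+1} A_i) = 0$ and $\dim(\mathrm{span}(\bigcup_{i=1}^{d+1} A_i)) \leq 2k$; it is a $d$-simplex-cluster if it is both a $d$-simplex and a $d$-cluster. -}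

module Defs where

open import Data.Nat using (ℕ; zero; suc; _+_; _*_; _∸_; _^_; _≤_; _<_)
open import Data.Nat.DivMod using (_/_)
open import Data.Nat.Primality using (Prime)
open import Data.Fin using (Fin)
import Data.Fin as Fin
open import Data.Product using (Σ; ∃; _×_; _,_)
open import Function using (_∘_; _↔_; _⇔_)
open import Function.Definitions using (Injective)
open import Relation.Nullary using (¬_)
open import Relation.Binary.PropositionalEquality using (_≡_)
open import Algebra.Core using (Op₁; Op₂)
open import Algebra.Structures using (IsCommutativeRing)

IsPrimePower : ℕ → Set
IsPrimePower q = Σ ℕ λ p → Σ ℕ λ m → Prime p × 1 ≤ m × q ≡ p ^ m

record FiniteField (q : ℕ) : Set₁ where
  field
    Carrier : Set
    _+F_ _*F_ : Op₂ Carrier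
    -F_ : Op₁ Carrier
    0# 1# : Carrier
    isCommutativeRing : IsCommutativeRing _≡_ _+F_ _*F_ -F_ 0# 1#
    0≢1 : ¬ (0# ≡ 1#)
    inverse : ∀ x → ¬ (x ≡ 0#) → Σ Carrier λ y → x *F y ≡ 1#
    enumeration : Carrier ↔ Fin q

-- Gaussian binomial coefficient, as in the paper:
-- [n k] = prod_{0 ≤ i ≤ k-1} (q^(n-i) - 1) / (q^(k-i) - 1),
-- computed as (product of numerators) / (product of denominators)
-- (exact division for q ≥ 2; the division is only used with q ≥ 2).
prodUpTo : ℕ → (ℕ → ℕ) → ℕ
prodUpTo zero f = 1
prodUpTo (suc k) f = prodUpTo k f * f k

_div_ : ℕ → ℕ → ℕ
m div zero = 0
m div suc d = m / suc d

gauss : (q n k : ℕ) → ℕ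
gauss q n k = prodUpTo k (λ i → q ^ (n ∸ i) ∸ 1) div prodUpTo k (λ i → q ^ (k ∸ i) ∸ 1)

module _ {q : ℕ} (F : FiniteField q) where
  open FiniteField F

  Vect : ℕ → Set
  Vect n = Fin n → Carrier

  -- subsets of F_q^n (subspaces are those subsets having a dimension)
  VSet : ℕ → Set₁
  VSet n = Vect n → Set

  lincomb : ∀ {n m} → (Fin m → Carrier) → (Fin m → Vect n) → Vect n
  lincomb {m = zero} c v = λ _ → 0#
  lincomb {m = suc m} c v = λ t → (c Fin.zero *F v Fin.zero t) +F lincomb (c ∘ Fin.suc) (v ∘ Fin.suc) t

  InSpan : ∀ {n m} → (Fin m → Vect n) → Vect n → Set
  InSpan {m = m} v x = Σ (Fin m → Carrier) λ c → ∀ t → x t ≡ lincomb c v t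

  LinIndep : ∀ {n m} → (Fin m → Vect n) → Set
  LinIndep {m = m} v = ∀ (c : Fin m → Carrier) → (∀ t → lincomb c v t ≡ 0#) → ∀ j → c j ≡ 0#

  HasDim : ∀ {n} → VSet n → ℕ → Set
  HasDim {n} W m = Σ (Fin m → Vect n) λ b → LinIndep b × (∀ x → W x ⇔ InSpan b x)

  ⋂ : ∀ {n r} → (Fin r → VSet n) → VSet n
  ⋂ A x = ∀ i → A i x

  SpanUnion : ∀ {n r} → (Fin r → VSet n) → VSet n
  SpanUnion {n} {r} A x = Σ ℕ λ m → Σ (Fin m → Carrier) λ c → Σ (Fin m → Vect n) λ v →
    (∀ j → Σ (Fin r) λ i → A i (v j)) × (∀ t → x t ≡ lincomb c v t)

  IsSimplex : ∀ {n} (d : ℕ) → (Fin (suc d) → VSet n) → Set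
  IsSimplex d A = HasDim (⋂ A) 0 ×
    (∀ (f : Fin d → Fin (suc d)) → Injective _≡_ _≡_ f →
       Σ ℕ λ m → 0 < m × HasDim (⋂ (A ∘ f)) m)

  IsCluster : ∀ {n} (k d : ℕ) → (Fin (suc d) → VSet n) → Set
  IsCluster k d A = HasDim (⋂ A) 0 × Σ ℕ λ m → m ≤ 2 * k × HasDim (SpanUnion A) m

  IsSimplexCluster : ∀ {n} (k d : ℕ) → (Fin (suc d) → VSet n) → Set
  IsSimplexCluster k d A = IsSimplex d A × IsCluster k d A

  SameSet : ∀ {n} → VSet n → VSet n → Set
  SameSet U W = ∀ x → U x ⇔ W x

{-# OPTIONS --safe #-}
-- The bound q^(n-k) [n-1, k-1] is about (1 - q^(-k)) [n, k], so a family reaching it misses only a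
-- fraction q^(-k) + o(1) of all k-spaces. Fix a simplex cluster made of coordinate subspaces of a space
-- of dimension m ≤ 2k and substitute a random m-tuple of vectors of F_q^n for the basis: the tuple is
-- dependent with probability o(1), and each of the d + 1 subspaces lies outside the family with
-- probability q^(-k) + o(1). As (d + 1) q^(-k) < 1, the union bound leaves, for n large, a tuple whose
-- d + 1 coordinate subspaces all belong to the family. Probabilities are ratios of counts of tuples, and
-- a k-space is counted through its ordered bases.
module Submission where

open import Defs
open import Data.Nat hiding (_≟_)
open import Data.Nat.Properties hiding (_≟_)
open import Data.Nat.DivMod using (m*n/n≡m)
open import Data.Nat.Primality using (prime⇒nonTrivial)
open import Data.Nat.Tactic.RingSolver using (solve-∀)
open import Data.Bool using (not; if_then_else_)
import Data.Bool.Properties as Bool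
open import Data.Fin using (Fin; zero; suc; _↑ˡ_; splitAt)
import Data.Fin.Properties as Fin
open import Data.Fin.Subset using (Subset; inside; outside; ∣_∣; ⁅_⁆; ∁) renaming (⊤ to full; ⊥ to empty)
open import Data.Fin.Subset.Properties using (∣⊤∣≡n; ∣⊥∣≡0; ∣⁅x⁆∣≡1; ∣∁p∣≡n∸∣p∣)
open import Data.List using (List; []; _∷_; _++_; map; length; cartesianProductWith; allFin)
import Data.List as List
import Data.List.Properties as List
open import Data.List.Membership.Propositional using (_∈_; lose)
open import Data.List.Membership.Propositional.Properties using (∈-cartesianProductWith⁺; ∈-tabulate⁺; ∈-allFin)
open import Data.List.Relation.Unary.Any as Any using (here; there)
open import Data.List.Relation.Unary.All as All using ([]; _∷_)
open import Data.List.Relation.Unary.AllPairs using ([]; _∷_)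
open import Data.List.Relation.Unary.Unique.Propositional using (Unique)
import Data.List.Relation.Unary.Unique.Propositional.Properties as Unique
open import Data.Vec using (Vec; []; _∷_; lookup; tabulate) renaming (_++_ to _++ᵛ_)
import Data.Vec.Properties as Vec
open import Data.Product using (Σ; ∃; _×_; _,_; proj₁; proj₂)
open import Data.Sum using (inj₁; inj₂)
open import Data.Unit using (⊤; tt)
open import Function using (_∘_; flip; id; _⇔_; mk⇔; Equivalence; Inverse)
open import Function.Definitions using (Injective)
open import Function.Properties.Inverse using (↔⇒↣)
open import Function.Properties.Equivalence using () renaming (trans to ⇔-trans; sym to ⇔-sym)
open import Algebra.Bundles using (CommutativeRing)
import Algebra.Properties.Ring as RingProperties
open import Relation.Nullary using (¬_; Dec; does; yes; no; contradiction)
open import Relation.Nullary.Decidable using (map′; via-injection; _×-dec_; ¬?; decidable-stable; dec-true; dec-false)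
open import Relation.Unary using (Decidable)
open import Relation.Binary.Definitions using (DecidableEquality)
open import Relation.Binary.PropositionalEquality


-- Gaussian binomial coefficients

-- The bound counts the `k`-spaces outside a fixed hyperplane, hence the difference of two Gaussian
-- coefficients. Put `Q = q ^ n` and `R = q ^ (n - k)`. The ordered bases of that many spaces number
-- `(q ^ k - 1) * R` times the product of `Q - q ^ i` over `0 < i < k`. The first factor is `Q - R`,
-- short of `Q` by the fraction `q ^ (-k)`; every later factor is short by an amount independent of
-- `n`. Bases are built vector by vector, so their counts are products. The coordinate subspaces
-- overlap, so the events that they miss the family are dependent; the union bound only uses that a
-- subtuple of a uniform tuple is uniform. Cleared of fractions, failure of every tuple would give
-- `Q ≤ s + (d + 1) * (R + t)` with `s` and `t` independent of `n`, against `Q = q ^ k * R`. The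
-- properties of tuples involved are decided by finite search, so the count yields an actual tuple.

primePower⇒2≤ : ∀ {q} → IsPrimePower q → 2 ≤ q
primePower⇒2≤ (p , suc m , p-prime , _ , refl) = begin
  2          ≤⟨ nonTrivial⇒n>1 p ⟩
  p          ≡⟨ *-identityʳ p ⟨
  p * 1      ≤⟨ *-monoʳ-≤ p (m^n>0 p m) ⟩
  p * p ^ m  ∎
  where
  open ≤-Reasoning
  instance
    _ = prime⇒nonTrivial p-prime
    _ = nonTrivial⇒nonZero p

prod-cong : ∀ l {f g} → (∀ i → i < l → f i ≡ g i) → prodUpTo l f ≡ prodUpTo l g
prod-cong zero    f≡g = refl
prod-cong (suc l) f≡g = cong₂ _*_ (prod-cong l λ i i<l → f≡g i (m<n⇒m<1+n i<l)) (f≡g l ≤-refl)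

prod-first : ∀ l f → prodUpTo (suc l) f ≡ f 0 * prodUpTo l (λ i → f (suc i))
prod-first zero    f = *-comm 1 (f 0)
prod-first (suc l) f = trans (cong (_* f (suc l)) (prod-first l f)) (*-assoc (f 0) _ _)

prod-* : ∀ l f g → prodUpTo l (λ i → f i * g i) ≡ prodUpTo l f * prodUpTo l g
prod-* zero    f g = refl
prod-* (suc l) f g = trans (cong (_* (f l * g l)) (prod-* l f g)) ([m*n]*[o*p]≡[m*o]*[n*p] (prodUpTo l f) (prodUpTo l g) (f l) (g l))

prod-pos : ∀ l f → (∀ i → i < l → 0 < f i) → 0 < prodUpTo l f
prod-pos zero    f f>0 = ≤-refl
prod-pos (suc l) f f>0 = *-mono-≤ (prod-pos l f λ i i<l → f>0 i (m<n⇒m<1+n i<l)) (f>0 l ≤-refl)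

sumUpTo : ℕ → (ℕ → ℕ) → ℕ
sumUpTo zero    a = 0
sumUpTo (suc l) a = sumUpTo l a + a l

prod-∸-upper : ∀ Q (a : ℕ → ℕ) l → prodUpTo l (λ i → Q ∸ a i) ≤ Q ^ l
prod-∸-upper Q a zero    = ≤-refl
prod-∸-upper Q a (suc l) = ≤-trans (*-mono-≤ (prod-∸-upper Q a l) (m∸n≤m Q (a l))) (≤-reflexive (*-comm (Q ^ l) Q))

-- The Weierstrass product inequality ∏ (Q - aᵢ) ≥ Q^l - Q^(l-1) Σ aᵢ, multiplied by Q.
prod-∸-lower : ∀ Q (a : ℕ → ℕ) l → Q * Q ^ l ≤ Q * prodUpTo l (λ i → Q ∸ a i) + Q ^ l * sumUpTo l a
prod-∸-lower Q a zero = m≤m+n _ _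
prod-∸-lower Q a (suc l) = begin
  Q * (Q * Q ^ l)                                               ≤⟨ *-monoʳ-≤ Q (prod-∸-lower Q a l) ⟩
  Q * (Q * W + Q ^ l * s)                                       ≡⟨ regroup Q W (Q ^ l) s ⟩
  Q * W * Q + Q * Q ^ l * s                                     ≤⟨ +-monoˡ-≤ _ (*-monoʳ-≤ (Q * W) (m≤n+m∸n Q (a l))) ⟩
  Q * W * (a l + (Q ∸ a l)) + Q * Q ^ l * s                     ≡⟨ expand Q W (Q ^ l) s (a l) (Q ∸ a l) ⟩
  Q * (W * (Q ∸ a l)) + (Q * Q ^ l * s + Q * W * a l)           ≤⟨ +-monoʳ-≤ (Q * (W * (Q ∸ a l))) (+-monoʳ-≤ (Q * Q ^ l * s) (*-monoˡ-≤ (a l) (*-monoʳ-≤ Q (prod-∸-upper Q a l)))) ⟩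
  Q * (W * (Q ∸ a l)) + (Q * Q ^ l * s + Q * Q ^ l * a l)       ≡⟨ cong (Q * (W * (Q ∸ a l)) +_) (*-distribˡ-+ (Q * Q ^ l) s (a l)) ⟨
  Q * (W * (Q ∸ a l)) + Q * Q ^ l * (s + a l)                   ∎
  where
  open ≤-Reasoning
  W = prodUpTo l (λ i → Q ∸ a i)
  s = sumUpTo l a
  regroup : ∀ Q W P s → Q * (Q * W + P * s) ≡ Q * W * Q + Q * P * s
  regroup = solve-∀
  expand : ∀ Q W P s x y → Q * W * (x + y) + Q * P * s ≡ Q * (W * y) + (Q * P * s + Q * W * x)
  expand = solve-∀

module GaussianBinomial (q : ℕ) (2≤q : 2 ≤ q) where

  instance
    q-nonZero : NonZero q
    q-nonZero = >-nonZero (≤-trans (s≤s z≤n) 2≤q)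

  numer : ℕ → ℕ → ℕ
  numer n k = prodUpTo k λ i → q ^ (n ∸ i) ∸ 1

  denom-pos : ∀ k → 0 < numer k k
  denom-pos k = prod-pos k _ λ i i<k →
    m<n⇒0<n∸m (≤-trans 2≤q (≤-trans (≤-reflexive (sym (*-identityʳ q))) (^-monoʳ-≤ q (m<n⇒0<n∸m i<k))))

  numer-zero : ∀ n k → n < k → numer n k ≡ 0
  numer-zero n (suc k) n<k with m≤n⇒m<n∨m≡n (≤-pred n<k)
  ... | inj₁ n<k′ = cong (_* (q ^ (n ∸ k) ∸ 1)) (numer-zero n k n<k′)
  ... | inj₂ refl = trans (cong (λ e → numer n n * (q ^ e ∸ 1)) (n∸n≡0 n)) (*-zeroʳ (numer n n))

  -- The quotient in `gauss` is rounded, so its exactness needs proof. The q-Pascal recursion gives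
  -- a natural number from the start, and `binomial*denom` identifies it with the quotient.
  binomial : ℕ → ℕ → ℕ
  binomial n       zero    = 1
  binomial zero    (suc k) = 0
  binomial (suc n) (suc k) = q ^ (n ∸ k) * binomial n k + binomial n (suc k)

  -- Both terms of the recursion carry the factor `numer n k`; what remains is `A * (q ^ (k + 1) -
  -- 1) + (A - 1) = q ^ (n + 1) - 1` for `A = q ^ (n - k)`.
  binomial*denom : ∀ n k → binomial n k * numer k k ≡ numer n k
  binomial*denom n       zero    = refl
  binomial*denom zero    (suc k) = sym (numer-zero 0 (suc k) (s≤s z≤n))
  binomial*denom (suc n) (suc k) = begin
    (A * B + binomial n (suc k)) * numer (suc k) (suc k)
      ≡⟨ *-distribʳ-+ (numer (suc k) (suc k)) (A * B) _ ⟩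
    A * B * numer (suc k) (suc k) + binomial n (suc k) * numer (suc k) (suc k)
      ≡⟨ cong₂ _+_ (cong (A * B *_) (prod-first k _)) (binomial*denom n (suc k)) ⟩
    A * B * ((q ^ suc k ∸ 1) * numer k k) + numer n k * (A ∸ 1)
      ≡⟨ cong (_+ numer n k * (A ∸ 1)) (regroup A B (q ^ suc k ∸ 1) (numer k k)) ⟩
    B * numer k k * (A * (q ^ suc k ∸ 1)) + numer n k * (A ∸ 1)
      ≡⟨ cong (λ x → x * (A * (q ^ suc k ∸ 1)) + numer n k * (A ∸ 1)) (binomial*denom n k) ⟩
    numer n k * (A * (q ^ suc k ∸ 1)) + numer n k * (A ∸ 1)
      ≡⟨ *-distribˡ-+ (numer n k) _ _ ⟨
    numer n k * (A * (q ^ suc k ∸ 1) + (A ∸ 1))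
      ≡⟨ telescope ⟩
    numer n k * (q ^ suc n ∸ 1)
      ≡⟨ *-comm (numer n k) _ ⟩
    (q ^ suc n ∸ 1) * numer n k
      ≡⟨ prod-first k _ ⟨
    numer (suc n) (suc k) ∎
    where
    open ≡-Reasoning
    A = q ^ (n ∸ k)
    B = binomial n k
    regroup : ∀ a b c d → a * b * (c * d) ≡ b * d * (a * c)
    regroup = solve-∀
    telescope : numer n k * (A * (q ^ suc k ∸ 1) + (A ∸ 1)) ≡ numer n k * (q ^ suc n ∸ 1)
    telescope with k ≤? n
    -- Here truncated subtraction makes `A = 1` and the identity for the cofactors fails, but the
    -- common factor vanishes.
    ... | no k≰n rewrite numer-zero n k (≰⇒> k≰n) = refl
    ... | yes k≤n = cong (numer n k *_) (begin
      A * (q ^ suc k ∸ 1) + (A ∸ 1)        ≡⟨ +-∸-assoc _ (m^n>0 q (n ∸ k)) ⟨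
      A * (q ^ suc k ∸ 1) + A ∸ 1          ≡⟨ cong (λ x → A * (q ^ suc k ∸ 1) + x ∸ 1) (*-identityʳ A) ⟨
      A * (q ^ suc k ∸ 1) + A * 1 ∸ 1      ≡⟨ cong (_∸ 1) (*-distribˡ-+ A _ 1) ⟨
      A * ((q ^ suc k ∸ 1) + 1) ∸ 1        ≡⟨ cong (λ x → A * x ∸ 1) (m∸n+n≡m (m^n>0 q (suc k))) ⟩
      A * q ^ suc k ∸ 1                    ≡⟨ cong (_∸ 1) (^-distribˡ-+-* q (n ∸ k) (suc k)) ⟨
      q ^ (n ∸ k + suc k) ∸ 1              ≡⟨ cong (λ e → q ^ e ∸ 1) (trans (+-suc (n ∸ k) k) (cong suc (m∸n+n≡m k≤n))) ⟩
      q ^ suc n ∸ 1                        ∎)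

  *-div-cancel : ∀ a d → 0 < d → (a * d) div d ≡ a
  *-div-cancel a (suc d) _ = m*n/n≡m a (suc d)

  gauss≡binomial : ∀ n k → gauss q n k ≡ binomial n k
  gauss≡binomial n k =
    trans (cong (_div numer k k) (sym (binomial*denom n k))) (*-div-cancel (binomial n k) (numer k k) (denom-pos k))

  gauss*denom : ∀ n k → gauss q n k * numer k k ≡ numer n k
  gauss*denom n k = trans (cong (_* numer k k) (gauss≡binomial n k)) (binomial*denom n k)

  gauss-pascal : ∀ n k → q ^ (n ∸ k) * gauss q n k ≡ gauss q (suc n) (suc k) ∸ gauss q n (suc k)
  gauss-pascal n k = begin
    q ^ (n ∸ k) * gauss q n k
      ≡⟨ cong (q ^ (n ∸ k) *_) (gauss≡binomial n k) ⟩
    q ^ (n ∸ k) * binomial n k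
      ≡⟨ m+n∸n≡m _ (binomial n (suc k)) ⟨
    binomial (suc n) (suc k) ∸ binomial n (suc k)
      ≡⟨ cong₂ _∸_ (gauss≡binomial (suc n) (suc k)) (gauss≡binomial n (suc k)) ⟨
    gauss q (suc n) (suc k) ∸ gauss q n (suc k) ∎
    where open ≡-Reasoning

  powers : ℕ → ℕ
  powers l = prodUpTo l λ i → q ^ suc i

  -- Restoring the powers of `q` turns the product from `gauss` into a count: the ways to extend one
  -- nonzero vector of an `(n + 1)`-dimensional space to `l + 1` independent vectors.
  powers*numer : ∀ n l → l ≤ n → powers l * numer n l ≡ prodUpTo l λ i → q ^ suc n ∸ q ^ suc i
  powers*numer n l l≤n = trans (sym (prod-* l (λ i → q ^ suc i) (λ i → q ^ (n ∸ i) ∸ 1))) (prod-cong l λ i i<l → begin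
    q ^ suc i * (q ^ (n ∸ i) ∸ 1)             ≡⟨ *-distribˡ-∸ (q ^ suc i) _ 1 ⟩
    q ^ suc i * q ^ (n ∸ i) ∸ q ^ suc i * 1   ≡⟨ cong₂ _∸_ (sym (^-distribˡ-+-* q (suc i) (n ∸ i))) (*-identityʳ (q ^ suc i)) ⟩
    q ^ (suc i + (n ∸ i)) ∸ q ^ suc i         ≡⟨ cong (λ e → q ^ suc e ∸ q ^ suc i) (m+[n∸m]≡n (≤-trans (<⇒≤ i<l) l≤n)) ⟩
    q ^ suc n ∸ q ^ suc i ∎)
    where open ≡-Reasoning

  -- The number of ordered bases of the k-spaces counted by q^(n-k) [n-1, k-1], with n = suc n′ and k = suc l.
  gauss-bases : ∀ n l → l ≤ n →
    q ^ (n ∸ l) * gauss q n l * prodUpTo (suc l) (λ i → q ^ suc l ∸ q ^ i)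
      ≡ (q ^ suc l ∸ 1) * q ^ (n ∸ l) * prodUpTo l (λ i → q ^ suc n ∸ q ^ suc i)
  gauss-bases n l l≤n = begin
    R * g * prodUpTo (suc l) (λ i → q ^ suc l ∸ q ^ i)
      ≡⟨ cong (R * g *_) (prod-first l _) ⟩
    R * g * ((q ^ suc l ∸ 1) * prodUpTo l (λ i → q ^ suc l ∸ q ^ suc i))
      ≡⟨ cong (λ x → R * g * ((q ^ suc l ∸ 1) * x)) (powers*numer l l ≤-refl) ⟨
    R * g * ((q ^ suc l ∸ 1) * (powers l * numer l l))
      ≡⟨ regroup R g (q ^ suc l ∸ 1) (powers l) (numer l l) ⟩
    (q ^ suc l ∸ 1) * R * (powers l * (g * numer l l))
      ≡⟨ cong (λ x → (q ^ suc l ∸ 1) * R * (powers l * x)) (gauss*denom n l) ⟩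
    (q ^ suc l ∸ 1) * R * (powers l * numer n l)
      ≡⟨ cong ((q ^ suc l ∸ 1) * R *_) (powers*numer n l l≤n) ⟩
    (q ^ suc l ∸ 1) * R * prodUpTo l (λ i → q ^ suc n ∸ q ^ suc i) ∎
    where
    open ≡-Reasoning
    R = q ^ (n ∸ l)
    g = gauss q n l
    regroup : ∀ r g a p d → r * g * (a * (p * d)) ≡ a * r * (p * (g * d))
    regroup = solve-∀

-- Estimates for the union bound, cleared of fractions

module _ (Q : ℕ) (a : ℕ → ℕ) where
  open ≤-Reasoning

  complement-upper : ∀ l {A I} → A + I ≡ Q ^ l → prodUpTo l (λ i → Q ∸ a i) ≤ I → Q * A ≤ Q ^ l * sumUpTo l a
  complement-upper l {A} {I} A+I≡Q^l W≤I = +-cancelʳ-≤ (Q * I) _ _ (begin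
    Q * A + Q * I                         ≡⟨ *-distribˡ-+ Q A I ⟨
    Q * (A + I)                           ≡⟨ cong (Q *_) A+I≡Q^l ⟩
    Q * Q ^ l                             ≤⟨ prod-∸-lower Q a l ⟩
    Q * _ + Q ^ l * sumUpTo l a           ≤⟨ +-monoˡ-≤ _ (*-monoʳ-≤ Q W≤I) ⟩
    Q * I + Q ^ l * sumUpTo l a           ≡⟨ +-comm (Q * I) _ ⟩
    Q ^ l * sumUpTo l a + Q * I           ∎)

  -- The first of `l + 1` factors is `(K ∸ 1) * R`, which is `Q` less `R`. That costs the fraction
  -- `R / Q = 1 / K`; the other `l` factors cost the sum of `a i / Q`, by the Weierstrass
  -- inequality.
  complement-upper′ : ∀ l {K R B G} → Q ≡ K * R → B + G ≡ Q ^ suc l →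
    (K ∸ 1) * R * prodUpTo l (λ i → Q ∸ a i) ≤ G → Q * B ≤ Q ^ suc l * (R + sumUpTo l a)
  complement-upper′ l {K} {R} {B} {G} Q≡KR B+G≡Q^l bound = +-cancelʳ-≤ (Q * G) _ _ (begin
    Q * B + Q * G                               ≡⟨ *-distribˡ-+ Q B G ⟨
    Q * (B + G)                                 ≡⟨ cong (Q *_) B+G≡Q^l ⟩
    Q * (Q * Q ^ l)                             ≤⟨ *-monoʳ-≤ Q (prod-∸-lower Q a l) ⟩
    Q * (Q * W + Q ^ l * s)                     ≤⟨ *-monoʳ-≤ Q (+-monoˡ-≤ (Q ^ l * s) QW≤) ⟩
    Q * (G + R * Q ^ l + Q ^ l * s)             ≡⟨ regroup Q G R (Q ^ l) s ⟩
    Q * Q ^ l * (R + s) + Q * G                 ∎)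
    where
    W = prodUpTo l (λ i → Q ∸ a i)
    s = sumUpTo l a
    regroup : ∀ Q G R P s → Q * (G + R * P + P * s) ≡ Q * P * (R + s) + Q * G
    regroup = solve-∀
    QW≤ : Q * W ≤ G + R * Q ^ l
    QW≤ = begin
      Q * W                              ≡⟨ cong (_* W) Q≡KR ⟩
      K * R * W                          ≤⟨ *-monoˡ-≤ W (*-monoˡ-≤ R (m≤n+m∸n K 1)) ⟩
      (R + (K ∸ 1) * R) * W              ≡⟨ *-distribʳ-+ W R _ ⟩
      R * W + (K ∸ 1) * R * W            ≤⟨ +-mono-≤ (*-monoʳ-≤ R (prod-∸-upper Q a l)) bound ⟩
      R * Q ^ l + G                      ≡⟨ +-comm (R * Q ^ l) G ⟩
      G + R * Q ^ l                      ∎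

-- Dividing the covering inequality by `Q ^ (r + k)` leaves `Q ≤ s + c * (R + t)`. The right side is
-- below `(c + 1) * R` since `R` exceeds `s + c * t`, and `(c + 1) * R ≤ K * R = Q`.
union-bound-fails : ∀ Q K R c r k s t A B → 0 < Q → Q ≡ K * R → c < K → s + c * t < R →
  Q * A ≤ Q ^ (r + k) * s → Q * B ≤ Q ^ k * (R + t) → ¬ (Q ^ (r + k) ≤ A + c * (Q ^ r * B))
union-bound-fails Q K R c r k s t A B 0<Q Q≡KR c<K R-large A-small B-small covered = <-irrefl refl (begin-strict
  s + c * (R + t)       ≡⟨ regroup₁ s c R t ⟩
  s + c * t + c * R     <⟨ +-monoˡ-< (c * R) R-large ⟩
  R + c * R             ≤⟨ *-monoˡ-≤ R c<K ⟩
  K * R                 ≡⟨ Q≡KR ⟨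
  Q                     ≤⟨ *-cancelˡ-≤ (Q ^ (r + k)) scaled ⟩
  s + c * (R + t)       ∎)
  where
  open ≤-Reasoning
  instance
    _ = >-nonZero 0<Q
    _ = m^n≢0 Q (r + k)
  regroup₁ : ∀ s c R t → s + c * (R + t) ≡ s + c * t + c * R
  regroup₁ = solve-∀
  regroup₂ : ∀ Q A c P B → Q * (A + c * (P * B)) ≡ Q * A + c * (P * (Q * B))
  regroup₂ = solve-∀
  regroup₃ : ∀ P P′ s c R t → P * P′ * s + c * (P * (P′ * (R + t))) ≡ P * P′ * (s + c * (R + t))
  regroup₃ = solve-∀
  scaled : Q ^ (r + k) * Q ≤ Q ^ (r + k) * (s + c * (R + t))
  scaled = begin
    Q ^ (r + k) * Q                                          ≡⟨ *-comm _ Q ⟩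
    Q * Q ^ (r + k)                                          ≤⟨ *-monoʳ-≤ Q covered ⟩
    Q * (A + c * (Q ^ r * B))                                ≡⟨ regroup₂ Q A c (Q ^ r) B ⟩
    Q * A + c * (Q ^ r * (Q * B))                            ≤⟨ +-mono-≤ A-small (*-monoʳ-≤ c (*-monoʳ-≤ (Q ^ r) B-small)) ⟩
    Q ^ (r + k) * s + c * (Q ^ r * (Q ^ k * (R + t)))        ≡⟨ cong (λ x → x * s + c * (Q ^ r * (Q ^ k * (R + t)))) (^-distribˡ-+-* Q r k) ⟩
    Q ^ r * Q ^ k * s + c * (Q ^ r * (Q ^ k * (R + t)))      ≡⟨ regroup₃ (Q ^ r) (Q ^ k) s c R t ⟩
    Q ^ r * Q ^ k * (s + c * (R + t))                        ≡⟨ cong (_* (s + c * (R + t))) (^-distribˡ-+-* Q r k) ⟨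
    Q ^ (r + k) * (s + c * (R + t))                          ∎

-- Sums and counts over lists

∑ : {A : Set} → List A → (A → ℕ) → ℕ
∑ []       f = 0
∑ (x ∷ xs) f = f x + ∑ xs f

⟦_⟧ : {P : Set} → Dec P → ℕ
⟦ P? ⟧ = if does P? then 1 else 0

module _ {P : Set} where

  ⟦⟧≤1 : (P? : Dec P) → ⟦ P? ⟧ ≤ 1
  ⟦⟧≤1 (yes _) = ≤-refl
  ⟦⟧≤1 (no  _) = z≤n

  ⟦⟧-true : (P? : Dec P) → P → 1 ≤ ⟦ P? ⟧
  ⟦⟧-true (yes _) p = ≤-refl
  ⟦⟧-true (no ¬p) p = contradiction p ¬p

  ⟦⟧-elim : (P? : Dec P) {n : ℕ} → (P → 1 ≤ n) → ⟦ P? ⟧ ≤ n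
  ⟦⟧-elim (yes p) P⇒1≤n = P⇒1≤n p
  ⟦⟧-elim (no  _) P⇒1≤n = z≤n

⟦⟧-× : {P Q : Set} (P? : Dec P) (Q? : Dec Q) → ⟦ P? ⟧ * ⟦ Q? ⟧ ≡ ⟦ P? ×-dec Q? ⟧
⟦⟧-× (yes _) Q? = +-identityʳ _
⟦⟧-× (no  _) Q? = refl

⟦⟧-¬ : {P : Set} (P? : Dec P) → ⟦ ¬? P? ⟧ + ⟦ P? ⟧ ≡ 1
⟦⟧-¬ (yes _) = refl
⟦⟧-¬ (no  _) = refl

module _ {A : Set} where

  ∑-mono : ∀ (xs : List A) {f g} → (∀ x → f x ≤ g x) → ∑ xs f ≤ ∑ xs g
  ∑-mono []       f≤g = z≤n
  ∑-mono (x ∷ xs) f≤g = +-mono-≤ (f≤g x) (∑-mono xs f≤g)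

  ∑-cong : ∀ (xs : List A) {f g} → (∀ x → f x ≡ g x) → ∑ xs f ≡ ∑ xs g
  ∑-cong []       f≡g = refl
  ∑-cong (x ∷ xs) f≡g = cong₂ _+_ (f≡g x) (∑-cong xs f≡g)

  ∑-+ : ∀ (xs : List A) f g → ∑ xs (λ x → f x + g x) ≡ ∑ xs f + ∑ xs g
  ∑-+ []       f g = refl
  ∑-+ (x ∷ xs) f g = trans (cong (f x + g x +_) (∑-+ xs f g)) (interchange (f x) (g x) (∑ xs f) (∑ xs g))
    where
    interchange : ∀ a b c d → a + b + (c + d) ≡ a + c + (b + d)
    interchange = solve-∀

  ∑-*ʳ : ∀ (xs : List A) f c → ∑ xs (λ x → f x * c) ≡ ∑ xs f * c
  ∑-*ʳ []       f c = refl
  ∑-*ʳ (x ∷ xs) f c = trans (cong (f x * c +_) (∑-*ʳ xs f c)) (sym (*-distribʳ-+ c (f x) (∑ xs f)))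

  ∑-const : ∀ (xs : List A) c → ∑ xs (λ _ → c) ≡ length xs * c
  ∑-const []       c = refl
  ∑-const (x ∷ xs) c = cong (c +_) (∑-const xs c)

  ∑-++ : ∀ (xs ys : List A) f → ∑ (xs ++ ys) f ≡ ∑ xs f + ∑ ys f
  ∑-++ []       ys f = refl
  ∑-++ (x ∷ xs) ys f = trans (cong (f x +_) (∑-++ xs ys f)) (sym (+-assoc (f x) _ _))

  ∑-term : ∀ {xs : List A} {x} f → x ∈ xs → f x ≤ ∑ xs f
  ∑-term f (here refl)          = m≤m+n _ _
  ∑-term f (there {x = y} x∈xs) = ≤-trans (∑-term f x∈xs) (m≤n+m _ (f y))

  ∑-vanish : ∀ (xs : List A) f → All.All (λ x → f x ≡ 0) xs → ∑ xs f ≡ 0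
  ∑-vanish []       f []         = refl
  ∑-vanish (x ∷ xs) f (eq ∷ eqs) = cong₂ _+_ eq (∑-vanish xs f eqs)

module _ {A : Set} where

  ∑-map : ∀ {B : Set} (g : B → A) ys f → ∑ (map g ys) f ≡ ∑ ys (f ∘ g)
  ∑-map g []       f = refl
  ∑-map g (y ∷ ys) f = cong (f (g y) +_) (∑-map g ys f)

  ∑-swap : ∀ {B : Set} (xs : List A) (ys : List B) (f : A → B → ℕ) → ∑ xs (λ x → ∑ ys (f x)) ≡ ∑ ys (λ y → ∑ xs (λ x → f x y))
  ∑-swap []       ys f = sym (∑-vanish ys _ (All.universal (λ _ → refl) ys))
  ∑-swap (x ∷ xs) ys f = trans (cong (∑ ys (f x) +_) (∑-swap xs ys f)) (sym (∑-+ ys (f x) _))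

  ∑-atMostOne : ∀ {xs : List A} → Unique xs → {P : A → Set} (P? : Decidable P) →
    (∀ x y → P x → P y → x ≡ y) → ∑ xs (λ x → ⟦ P? x ⟧) ≤ 1
  ∑-atMostOne []               P? P-unique = z≤n
  ∑-atMostOne {x ∷ xs} (x∉xs ∷ xs!) P? P-unique with P? x
  ... | no  _ = ∑-atMostOne xs! P? P-unique
  ... | yes p = s≤s (≤-reflexive (∑-vanish xs _ (All.map absent x∉xs)))
    where
    absent : ∀ {y} → x ≢ y → ⟦ P? y ⟧ ≡ 0
    absent {y} x≢y with P? y
    ... | yes p′ = contradiction (P-unique x y p p′) x≢y
    ... | no  _  = refl

  ∑-∃! : ∀ {xs : List A} → Unique xs → {P : A → Set} (P? : Decidable P) {Q : Set} (Q? : Dec Q) →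
    (∀ x y → P x → P y → x ≡ y) → (∀ x → P x → Q) → ∑ xs (λ x → ⟦ P? x ⟧) ≤ ⟦ Q? ⟧
  ∑-∃! xs! P? (yes q) P-unique P⇒Q = ∑-atMostOne xs! P? P-unique
  ∑-∃! {xs} xs! P? (no ¬q) P-unique P⇒Q = ≤-reflexive (∑-vanish xs _ (All.universal absent xs))
    where
    absent : ∀ x → ⟦ P? x ⟧ ≡ 0
    absent x with P? x
    ... | yes p = contradiction (P⇒Q x p) ¬q
    ... | no  _ = refl

module _ {A : Set} where

  module _ {B : Set} (_≟_ : DecidableEquality A) {xs : List A} (xs! : Unique xs) {ys : List B}
           {P : A → Set} (P? : Decidable P) (g : B → A) where
    open ≤-Reasoning

    -- This bound and the next one count the pairs `(x , y)` with `x ≡ g y` in two ways; each `y`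
    -- contributes to exactly one `x`.
    count-image-≤ : (∀ x → P x → ∃ λ y → y ∈ ys × x ≡ g y) → ∑ xs (λ x → ⟦ P? x ⟧) ≤ length ys
    count-image-≤ covered = begin
      ∑ xs (λ x → ⟦ P? x ⟧)
        ≤⟨ ∑-mono xs (λ x → ⟦⟧-elim (P? x) λ p → let y , y∈ys , x≡gy = covered x p in
             ≤-trans (⟦⟧-true (x ≟ g y) x≡gy) (∑-term (λ y → ⟦ x ≟ g y ⟧) y∈ys)) ⟩
      ∑ xs (λ x → ∑ ys λ y → ⟦ x ≟ g y ⟧)
        ≡⟨ ∑-swap xs ys _ ⟩
      ∑ ys (λ y → ∑ xs λ x → ⟦ x ≟ g y ⟧)
        ≤⟨ ∑-mono ys (λ y → ∑-atMostOne xs! (_≟ g y) λ x x′ p p′ → trans p (sym p′)) ⟩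
      ∑ ys (λ y → 1)
        ≡⟨ trans (∑-const ys 1) (*-identityʳ _) ⟩
      length ys ∎

    count-image-≥ : Unique ys → (∀ y → g y ∈ xs) → (∀ y → P (g y)) → (∀ y y′ → g y ≡ g y′ → y ≡ y′) →
      length ys ≤ ∑ xs (λ x → ⟦ P? x ⟧)
    count-image-≥ ys! g∈xs Pg g-injective = begin
      length ys
        ≡⟨ trans (∑-const ys 1) (*-identityʳ _) ⟨
      ∑ ys (λ y → 1)
        ≤⟨ ∑-mono ys (λ y → ≤-trans (⟦⟧-true (g y ≟ g y) refl) (∑-term (λ x → ⟦ x ≟ g y ⟧) (g∈xs y))) ⟩
      ∑ ys (λ y → ∑ xs λ x → ⟦ x ≟ g y ⟧)
        ≡⟨ ∑-swap xs ys _ ⟨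
      ∑ xs (λ x → ∑ ys λ y → ⟦ x ≟ g y ⟧)
        ≤⟨ ∑-mono xs (λ x → ∑-∃! ys! (λ y → x ≟ g y) (P? x)
             (λ y y′ p p′ → g-injective y y′ (trans (sym p) p′)) λ y p → subst P (sym p) (Pg y)) ⟩
      ∑ xs (λ x → ⟦ P? x ⟧) ∎

  -- The flipped constructor puts the tail in the outer loop and the head in the inner one, so that
  -- `∑-vecs` sums over the one-vector extensions of a fixed tuple.
  vecs : List A → ∀ n → List (Vec A n)
  vecs xs zero    = [] ∷ []
  vecs xs (suc n) = cartesianProductWith (flip _∷_) (vecs xs n) xs

  vecs-unique : ∀ {xs} → Unique xs → ∀ n → Unique (vecs xs n)
  vecs-unique xs! zero    = [] ∷ []
  vecs-unique xs! (suc n) =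
    Unique.cartesianProductWith⁺ (flip _∷_) (λ eq → Vec.∷-injectiveʳ eq , Vec.∷-injectiveˡ eq) (vecs-unique xs! n) xs!

  vecs-complete : ∀ {xs} → (∀ x → x ∈ xs) → ∀ {n} (v : Vec A n) → v ∈ vecs xs n
  vecs-complete ∈xs []      = here refl
  vecs-complete ∈xs (x ∷ v) = ∈-cartesianProductWith⁺ (flip _∷_) (vecs-complete ∈xs v) (∈xs x)

  ∑-vecs : ∀ xs n f → ∑ (vecs xs (suc n)) f ≡ ∑ (vecs xs n) (λ v → ∑ xs λ x → f (x ∷ v))
  ∑-vecs xs n f = go (vecs xs n)
    where
    go : ∀ vs → ∑ (cartesianProductWith (flip _∷_) vs xs) f ≡ ∑ vs (λ v → ∑ xs λ x → f (x ∷ v))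
    go []       = refl
    go (v ∷ vs) = trans (∑-++ (map (_∷ v) xs) _ f) (cong₂ _+_ (∑-map (_∷ v) xs f) (go vs))

  length-vecs : ∀ xs n → length (vecs xs n) ≡ length xs ^ n
  length-vecs xs zero    = refl
  length-vecs xs (suc n) = begin
    length (vecs xs (suc n))                    ≡⟨ length≡∑ (vecs xs (suc n)) ⟩
    ∑ (vecs xs (suc n)) (λ _ → 1)               ≡⟨ ∑-vecs xs n (λ _ → 1) ⟩
    ∑ (vecs xs n) (λ _ → ∑ xs λ _ → 1)          ≡⟨ ∑-const (vecs xs n) _ ⟩
    length (vecs xs n) * ∑ xs (λ _ → 1)         ≡⟨ cong₂ _*_ (length-vecs xs n) (sym (length≡∑ xs)) ⟩
    length xs ^ n * length xs                   ≡⟨ *-comm (length xs ^ n) _ ⟩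
    length xs ^ suc n                           ∎
    where
    open ≡-Reasoning
    length≡∑ : ∀ {B : Set} (zs : List B) → length zs ≡ ∑ zs (λ _ → 1)
    length≡∑ zs = sym (trans (∑-const zs 1) (*-identityʳ _))

  select : ∀ {n} (p : Subset n) → Vec A n → Vec A ∣ p ∣
  select []            []      = []
  select (inside  ∷ p) (x ∷ v) = x ∷ select p v
  select (outside ∷ p) (x ∷ v) = select p v

  -- Uniformity of the marginals: the entries outside `p` are free, so the mean of `f ∘ select p` is
  -- the mean of `f`. Cross-multiplication avoids the exponent `n ∸ ∣ p ∣`.
  ∑-select : ∀ xs {n} (p : Subset n) f →
    length xs ^ ∣ p ∣ * ∑ (vecs xs n) (f ∘ select p) ≡ length xs ^ n * ∑ (vecs xs ∣ p ∣) f
  ∑-select xs []                      f = refl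
  ∑-select xs {suc n} (inside  ∷ p) f = begin
    L ^ suc ∣ p ∣ * ∑ (vecs xs (suc n)) (f ∘ select (inside ∷ p))
      ≡⟨ cong (L ^ suc ∣ p ∣ *_) (∑-vecs xs n _) ⟩
    L * L ^ ∣ p ∣ * ∑ (vecs xs n) (λ v → ∑ xs λ x → f (x ∷ select p v))
      ≡⟨ *-assoc L _ _ ⟩
    L * (L ^ ∣ p ∣ * ∑ (vecs xs n) (λ v → ∑ xs λ x → f (x ∷ select p v)))
      ≡⟨ cong (L *_) (∑-select xs p λ u → ∑ xs λ x → f (x ∷ u)) ⟩
    L * (L ^ n * ∑ (vecs xs ∣ p ∣) (λ u → ∑ xs λ x → f (x ∷ u)))
      ≡⟨ *-assoc L _ _ ⟨
    L ^ suc n * ∑ (vecs xs ∣ p ∣) (λ u → ∑ xs λ x → f (x ∷ u))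
      ≡⟨ cong (L ^ suc n *_) (∑-vecs xs ∣ p ∣ f) ⟨
    L ^ suc n * ∑ (vecs xs (suc ∣ p ∣)) f ∎
    where
    open ≡-Reasoning
    L = length xs
  ∑-select xs {suc n} (outside ∷ p) f = begin
    L ^ ∣ p ∣ * ∑ (vecs xs (suc n)) (f ∘ select (outside ∷ p))
      ≡⟨ cong (L ^ ∣ p ∣ *_) (trans (∑-vecs xs n _) (trans (∑-cong (vecs xs n) λ v →
           trans (∑-const xs _) (*-comm L _)) (∑-*ʳ (vecs xs n) _ L))) ⟩
    L ^ ∣ p ∣ * (∑ (vecs xs n) (f ∘ select p) * L)
      ≡⟨ *-assoc (L ^ ∣ p ∣) _ L ⟨
    L ^ ∣ p ∣ * ∑ (vecs xs n) (f ∘ select p) * L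
      ≡⟨ cong (_* L) (∑-select xs p f) ⟩
    L ^ n * ∑ (vecs xs ∣ p ∣) f * L
      ≡⟨ rotate (L ^ n) _ L ⟩
    L * L ^ n * ∑ (vecs xs ∣ p ∣) f ∎
    where
    open ≡-Reasoning
    L = length xs
    rotate : ∀ a b c → a * b * c ≡ c * a * b
    rotate = solve-∀

-- Linear algebra over a finite field

module LinearAlgebra {q : ℕ} (F : FiniteField q) where
  open FiniteField F
  open ≡-Reasoning

  𝔽 : CommutativeRing _ _
  𝔽 = record { isCommutativeRing = isCommutativeRing }

  private
    module R = CommutativeRing 𝔽
    module RP = RingProperties R.ring

  infix 4 _≟_
  _≟_ : DecidableEquality Carrier
  _≟_ = via-injection (↔⇒↣ enumeration) Fin._≟_

  scalars : List Carrier
  scalars = List.tabulate (Inverse.from enumeration)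

  scalars-complete : ∀ x → x ∈ scalars
  scalars-complete x = subst (_∈ scalars) (Inverse.strictlyInverseʳ enumeration x) (∈-tabulate⁺ (Inverse.to enumeration x))

  scalars-unique : Unique scalars
  scalars-unique = Unique.tabulate⁺ λ {i} {j} eq →
    trans (sym (Inverse.strictlyInverseˡ enumeration i)) (trans (cong (Inverse.to enumeration) eq) (Inverse.strictlyInverseˡ enumeration j))

  lincomb-cong : ∀ {n m} {c c′ : Fin m → Carrier} {v : Fin m → Vect F n} → (∀ j → c j ≡ c′ j) →
    ∀ t → lincomb F c v t ≡ lincomb F c′ v t
  lincomb-cong {m = zero}  c≡c′ t = refl
  lincomb-cong {m = suc m} c≡c′ t = cong₂ _+F_ (cong (_*F _) (c≡c′ zero)) (lincomb-cong (c≡c′ ∘ suc) t)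

  lincomb-axpy : ∀ {n m} a (c c′ : Fin m → Carrier) (v : Fin m → Vect F n) t →
    lincomb F (λ j → (a *F c j) +F c′ j) v t ≡ (a *F lincomb F c v t) +F lincomb F c′ v t
  lincomb-axpy {m = zero}  a c c′ v t = sym (trans (R.+-identityʳ _) (R.zeroʳ a))
  lincomb-axpy {m = suc m} a c c′ v t = begin
    (((a *F c zero) +F c′ zero) *F x) +F lincomb F (λ j → (a *F c (suc j)) +F c′ (suc j)) (v ∘ suc) t
      ≡⟨ cong₂ _+F_ (R.distribʳ x _ _) (lincomb-axpy a (c ∘ suc) (c′ ∘ suc) (v ∘ suc) t) ⟩
    (((a *F c zero) *F x) +F (c′ zero *F x)) +F ((a *F L) +F L′)
      ≡⟨ R.+-assoc _ _ _ ⟩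
    ((a *F c zero) *F x) +F ((c′ zero *F x) +F ((a *F L) +F L′))
      ≡⟨ cong (((a *F c zero) *F x) +F_) (trans (sym (R.+-assoc _ _ _)) (trans (cong (_+F L′) (R.+-comm _ _)) (R.+-assoc _ _ _))) ⟩
    ((a *F c zero) *F x) +F ((a *F L) +F ((c′ zero *F x) +F L′))
      ≡⟨ R.+-assoc _ _ _ ⟨
    (((a *F c zero) *F x) +F (a *F L)) +F ((c′ zero *F x) +F L′)
      ≡⟨ cong (_+F ((c′ zero *F x) +F L′)) (trans (cong (_+F (a *F L)) (R.*-assoc _ _ _)) (sym (R.distribˡ a _ _))) ⟩
    (a *F ((c zero *F x) +F L)) +F ((c′ zero *F x) +F L′) ∎
    where
    x = v zero t
    L = lincomb F (c ∘ suc) (v ∘ suc) t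
    L′ = lincomb F (c′ ∘ suc) (v ∘ suc) t

  lincomb-0 : ∀ {n m} (v : Fin m → Vect F n) t → lincomb F (λ _ → 0#) v t ≡ 0#
  lincomb-0 {m = zero}  v t = refl
  lincomb-0 {m = suc m} v t = trans (cong₂ _+F_ (R.zeroˡ _) (lincomb-0 (v ∘ suc) t)) (R.+-identityˡ 0#)

  unit : ∀ {m} → Fin m → Fin m → Carrier
  unit zero    zero    = 1#
  unit zero    (suc j) = 0#
  unit (suc i) zero    = 0#
  unit (suc i) (suc j) = unit i j

  unit-diagonal : ∀ {m} (i : Fin m) → unit i i ≡ 1#
  unit-diagonal zero    = refl
  unit-diagonal (suc i) = unit-diagonal i

  unit-offDiagonal : ∀ {m} (i j : Fin m) → i ≢ j → unit i j ≡ 0#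
  unit-offDiagonal zero    zero    i≢j = contradiction refl i≢j
  unit-offDiagonal zero    (suc j) i≢j = refl
  unit-offDiagonal (suc i) zero    i≢j = refl
  unit-offDiagonal (suc i) (suc j) i≢j = unit-offDiagonal i j (i≢j ∘ cong suc)

  lincomb-unit : ∀ {n m} (i : Fin m) (v : Fin m → Vect F n) t → lincomb F (unit i) v t ≡ v i t
  lincomb-unit zero    v t = trans (cong₂ _+F_ (R.*-identityˡ _) (lincomb-0 (v ∘ suc) t)) (R.+-identityʳ _)
  lincomb-unit (suc i) v t = trans (cong₂ _+F_ (R.zeroˡ _) (lincomb-unit i (v ∘ suc) t)) (R.+-identityˡ _)

  coordinates-unique : ∀ {n m} {v : Fin m → Vect F n} → LinIndep F v → ∀ c c′ →
    (∀ t → lincomb F c v t ≡ lincomb F c′ v t) → ∀ j → c j ≡ c′ j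
  coordinates-unique {v = v} indep c c′ eq j = begin
    c j                                      ≡⟨ R.+-identityˡ _ ⟨
    0# +F c j                                ≡⟨ cong (_+F c j) (R.-‿inverseʳ _) ⟨
    (c′ j +F (-F c′ j)) +F c j               ≡⟨ R.+-assoc _ _ _ ⟩
    c′ j +F ((-F c′ j) +F c j)               ≡⟨ cong (λ x → c′ j +F (x +F c j)) (trans (cong -F_ (sym (R.*-identityˡ _))) (RP.-‿distribˡ-* 1# (c′ j))) ⟩
    c′ j +F (((-F 1#) *F c′ j) +F c j)       ≡⟨ cong (c′ j +F_) (indep (λ i → ((-F 1#) *F c′ i) +F c i) difference j) ⟩
    c′ j +F 0#                               ≡⟨ R.+-identityʳ _ ⟩
    c′ j                                     ∎
    where
    difference : ∀ t → lincomb F (λ i → ((-F 1#) *F c′ i) +F c i) v t ≡ 0#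
    difference t = begin
      lincomb F (λ i → ((-F 1#) *F c′ i) +F c i) v t          ≡⟨ lincomb-axpy (-F 1#) c′ c v t ⟩
      ((-F 1#) *F lincomb F c′ v t) +F lincomb F c v t        ≡⟨ cong₂ _+F_ (trans (sym (RP.-‿distribˡ-* 1# _)) (cong -F_ (R.*-identityˡ _))) (eq t) ⟩
      (-F lincomb F c′ v t) +F lincomb F c′ v t               ≡⟨ R.-‿inverseˡ _ ⟩
      0#                                                      ∎

  module _ {n m} {v : Fin m → Vect F n} where

    span-resp : ∀ {x y} → (∀ t → x t ≡ y t) → InSpan F v x → InSpan F v y
    span-resp x≡y (c , x≡) = c , λ t → trans (sym (x≡y t)) (x≡ t)

    span-axpy : ∀ a {x y} → InSpan F v x → InSpan F v y → InSpan F v (λ t → (a *F x t) +F y t)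
    span-axpy a (c , x≡) (c′ , y≡) = (λ j → (a *F c j) +F c′ j) ,
      λ t → trans (cong₂ _+F_ (cong (a *F_) (x≡ t)) (y≡ t)) (sym (lincomb-axpy a c c′ v t))

    span-0 : InSpan F v (λ _ → 0#)
    span-0 = (λ _ → 0#) , λ t → sym (lincomb-0 v t)

    span-lincomb : ∀ {l} (u : Fin l → Vect F n) → (∀ j → InSpan F v (u j)) → ∀ c → InSpan F v (lincomb F c u)
    span-lincomb {zero}  u u∈ c = span-0
    span-lincomb {suc l} u u∈ c = span-axpy (c zero) (u∈ zero) (span-lincomb (u ∘ suc) (u∈ ∘ suc) (c ∘ suc))

    span-trans : ∀ {l} {u : Fin l → Vect F n} → (∀ j → InSpan F v (u j)) → ∀ {x} → InSpan F u x → InSpan F v x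
    span-trans {u = u} u∈ (c , x≡) = span-resp (sym ∘ x≡) (span-lincomb u u∈ c)

  abstract
    -- All coefficient vectors are tried. Only the existence of a decision matters later, so the
    -- search is sealed.
    inSpan? : ∀ {n m} (v : Fin m → Vect F n) x → Dec (InSpan F v x)
    inSpan? {m = m} v x =
      map′ (λ found → let c , x≡ = Any.satisfied found in lookup c , x≡)
           (λ (c , x≡) → lose (vecs-complete scalars-complete (tabulate c))
             λ t → trans (x≡ t) (lincomb-cong (λ j → sym (Vec.lookup∘tabulate c j)) t))
           (Any.any? (λ c → Fin.all? λ t → x t ≟ lincomb F (lookup c) v t) (vecs scalars m))

  family : ∀ {n m} → Vec (Vec Carrier n) m → Fin m → Vect F n
  family T j = lookup (lookup T j)

  -- Independence in greedy form, each vector avoiding the span of those after it: this is the form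
  -- that can be counted one vector at a time. `P` confines the vectors to a subspace, or is
  -- trivial.
  IndepIn : ∀ {n m} → (Vec Carrier n → Set) → Vec (Vec Carrier n) m → Set
  IndepIn P []      = ⊤
  IndepIn P (x ∷ T) = (P x × ¬ InSpan F (family T) (lookup x)) × IndepIn P T

  indepIn? : ∀ {n m} {P : Vec Carrier n → Set} → Decidable P → (T : Vec (Vec Carrier n) m) → Dec (IndepIn P T)
  indepIn? P? []      = yes tt
  indepIn? P? (x ∷ T) = (P? x ×-dec ¬? (inSpan? (family T) (lookup x))) ×-dec indepIn? P? T

  indepIn⇒∈ : ∀ {n m} {P : Vec Carrier n → Set} (T : Vec (Vec Carrier n) m) → IndepIn P T → ∀ j → P (lookup T j)
  indepIn⇒∈ (x ∷ T) ((Px , _) , _) zero    = Px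
  indepIn⇒∈ (x ∷ T) (_ , indep)    (suc j) = indepIn⇒∈ T indep j

  indepIn⇒linIndep : ∀ {n m} {P : Vec Carrier n → Set} (T : Vec (Vec Carrier n) m) → IndepIn P T → LinIndep F (family T)
  indepIn⇒linIndep (x ∷ T) ((_ , x∉) , indep) c c≡0 = λ where
      zero    → c₀≡0
      (suc j) → indepIn⇒linIndep T indep (c ∘ suc) rest j
    where
    L = lincomb F (c ∘ suc) (family T)
    c₀≡0 : c zero ≡ 0#
    c₀≡0 with c zero ≟ 0#
    ... | yes c₀≡0 = c₀≡0
    -- Dividing the relation by its leading coefficient would put `x` into the span of the tail.
    ... | no  c₀≢0 = contradiction (span-resp solved (span-axpy (-F y) (c ∘ suc , λ t → refl) span-0)) x∉
      where
      y = proj₁ (inverse (c zero) c₀≢0)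
      solved : ∀ t → ((-F y) *F L t) +F 0# ≡ lookup x t
      solved t = begin
        ((-F y) *F L t) +F 0#          ≡⟨ R.+-identityʳ _ ⟩
        (-F y) *F L t                  ≡⟨ trans (sym (RP.-‿distribˡ-* y _)) (RP.-‿distribʳ-* y _) ⟩
        y *F (-F L t)                  ≡⟨ cong (y *F_) (RP.+-inverseˡ-unique _ _ (c≡0 t)) ⟨
        y *F (c zero *F lookup x t)    ≡⟨ R.*-assoc _ _ _ ⟨
        (y *F c zero) *F lookup x t    ≡⟨ cong (_*F lookup x t) (trans (R.*-comm _ _) (proj₂ (inverse (c zero) c₀≢0))) ⟩
        1# *F lookup x t               ≡⟨ R.*-identityˡ _ ⟩
        lookup x t                     ∎
    rest : ∀ t → L t ≡ 0#
    rest t = begin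
      L t                                      ≡⟨ R.+-identityˡ _ ⟨
      0# +F L t                                ≡⟨ cong (_+F L t) (trans (cong (_*F lookup x t) c₀≡0) (R.zeroˡ _)) ⟨
      (c zero *F lookup x t) +F L t            ≡⟨ c≡0 t ⟩
      0#                                       ∎

  extend : ∀ {m} (p : Subset m) → (Fin ∣ p ∣ → Carrier) → Fin m → Carrier
  extend (inside  ∷ p) c zero    = c zero
  extend (inside  ∷ p) c (suc j) = extend p (c ∘ suc) j
  extend (outside ∷ p) c zero    = 0#
  extend (outside ∷ p) c (suc j) = extend p c j

  restrict : ∀ {m} (p : Subset m) → (Fin m → Carrier) → Fin ∣ p ∣ → Carrier
  restrict (inside  ∷ p) c zero    = c zero
  restrict (inside  ∷ p) c (suc j) = restrict p (c ∘ suc) j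
  restrict (outside ∷ p) c j       = restrict p (c ∘ suc) j

  VanishesOff : ∀ {m} → Subset m → (Fin m → Carrier) → Set
  VanishesOff p c = ∀ j → lookup p j ≡ outside → c j ≡ 0#

  extend-vanishes : ∀ {m} (p : Subset m) c → VanishesOff p (extend p c)
  extend-vanishes (inside  ∷ p) c (suc j) eq = extend-vanishes p (c ∘ suc) j eq
  extend-vanishes (outside ∷ p) c zero    eq = refl
  extend-vanishes (outside ∷ p) c (suc j) eq = extend-vanishes p c j eq

  extend≡0 : ∀ {m} (p : Subset m) c → (∀ j → extend p c j ≡ 0#) → ∀ j → c j ≡ 0#
  extend≡0 (inside  ∷ p) c eq zero    = eq zero
  extend≡0 (inside  ∷ p) c eq (suc j) = extend≡0 p (c ∘ suc) (eq ∘ suc) j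
  extend≡0 (outside ∷ p) c eq j       = extend≡0 p c (eq ∘ suc) j

  lincomb-extend : ∀ {n m} (p : Subset m) (T : Vec (Vec Carrier n) m) c t →
    lincomb F (extend p c) (family T) t ≡ lincomb F c (family (select p T)) t
  lincomb-extend []            []      c t = refl
  lincomb-extend (inside  ∷ p) (x ∷ T) c t = cong ((c zero *F lookup x t) +F_) (lincomb-extend p T (c ∘ suc) t)
  lincomb-extend (outside ∷ p) (x ∷ T) c t =
    trans (cong₂ _+F_ (R.zeroˡ _) (lincomb-extend p T c t)) (R.+-identityˡ _)

  lincomb-restrict : ∀ {n m} (p : Subset m) (T : Vec (Vec Carrier n) m) c → VanishesOff p c → ∀ t →
    lincomb F c (family T) t ≡ lincomb F (restrict p c) (family (select p T)) t
  lincomb-restrict []            []      c van t = refl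
  lincomb-restrict (inside  ∷ p) (x ∷ T) c van t =
    cong ((c zero *F lookup x t) +F_) (lincomb-restrict p T (c ∘ suc) (van ∘ suc) t)
  lincomb-restrict (outside ∷ p) (x ∷ T) c van t =
    trans (cong₂ _+F_ (trans (cong (_*F lookup x t) (van zero refl)) (R.zeroˡ _)) (lincomb-restrict p T (c ∘ suc) (van ∘ suc) t)) (R.+-identityˡ _)

  -- Coefficients are indexed by all of `T`, not by `select p T`, so that members of different
  -- coordinate subspaces can be compared coefficient by coefficient.
  Coordinate : ∀ {n m} → Vec (Vec Carrier n) m → Subset m → VSet F n
  Coordinate {m = m} T p x = Σ (Fin m → Carrier) λ c → VanishesOff p c × (∀ t → x t ≡ lincomb F c (family T) t)

  coordinate⇔span : ∀ {n m} (T : Vec (Vec Carrier n) m) p x → Coordinate T p x ⇔ InSpan F (family (select p T)) x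
  coordinate⇔span T p x = mk⇔
    (λ (c , van , x≡) → restrict p c , λ t → trans (x≡ t) (lincomb-restrict p T c van t))
    (λ (c , x≡) → extend p c , extend-vanishes p c , λ t → trans (x≡ t) (sym (lincomb-extend p T c t)))

  intersection : ∀ {m r} → (Fin r → Subset m) → Subset m
  intersection ps = tabulate λ j → does (Fin.all? λ i → lookup (ps i) j Bool.≟ inside)

  intersection-inside : ∀ {m r} (ps : Fin r → Subset m) j → (∀ i → lookup (ps i) j ≡ inside) → lookup (intersection ps) j ≡ inside
  intersection-inside ps j all = trans (Vec.lookup∘tabulate _ j) (dec-true (Fin.all? λ i → lookup (ps i) j Bool.≟ inside) all)

  intersection-outside : ∀ {m r} (ps : Fin r → Subset m) j i → lookup (ps i) j ≡ outside → lookup (intersection ps) j ≡ outside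
  intersection-outside ps j i j∉ = trans (Vec.lookup∘tabulate _ j)
    (dec-false (Fin.all? λ i → lookup (ps i) j Bool.≟ inside) λ all → contradiction (trans (sym (all i)) j∉) λ ())

  module _ {n m} (T : Vec (Vec Carrier n) m) (indep : LinIndep F (family T)) where

    select-indep : ∀ p → LinIndep F (family (select p T))
    select-indep p c c≡0 = extend≡0 p c (indep (extend p c) λ t → trans (lincomb-extend p T c t) (c≡0 t))

    coordinate-dim : ∀ p {W : VSet F n} → (∀ x → W x ⇔ Coordinate T p x) → HasDim F W ∣ p ∣
    coordinate-dim p W⇔ = family (select p T) , select-indep p , λ x → ⇔-trans (W⇔ x) (coordinate⇔span T p x)

    coordinate-member : ∀ p j → lookup p j ≡ inside → Coordinate T p (family T j)
    coordinate-member p j j∈p = unit j ,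
      (λ i i∉p → unit-offDiagonal j i λ { refl → contradiction (trans (sym j∈p) i∉p) λ () }) ,
      λ t → sym (lincomb-unit j (family T) t)

    coordinate-nonmember : ∀ p j → lookup p j ≡ outside → ¬ Coordinate T p (family T j)
    coordinate-nonmember p j j∉p (c , van , eq) = 0≢1 (begin
      0#          ≡⟨ van j j∉p ⟨
      c j         ≡⟨ coordinates-unique indep c (unit j) (λ t → trans (sym (eq t)) (sym (lincomb-unit j (family T) t))) j ⟩
      unit j j    ≡⟨ unit-diagonal j ⟩
      1#          ∎)

    -- A common member has one coefficient vector by independence, so the coefficient at any index
    -- omitted by some pattern is zero. The family is nonempty so that its first member can supply
    -- that vector.
    coordinate-⋂ : ∀ {r} (A : Fin (suc r) → VSet F n) ps → (∀ i x → A i x ⇔ Coordinate T (ps i) x) →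
      ∀ x → ⋂ F A x ⇔ Coordinate T (intersection ps) x
    coordinate-⋂ {r} A ps A⇔ x = mk⇔ to′ from′
      where
      to′ : ⋂ F A x → Coordinate T (intersection ps) x
      to′ x∈ = proj₁ (coords zero) , vanishes , proj₂ (proj₂ (coords zero))
        where
        coords = λ i → Equivalence.to (A⇔ i x) (x∈ i)
        vanishes : VanishesOff (intersection ps) (proj₁ (coords zero))
        vanishes j j∉ with Fin.all? (λ i → lookup (ps i) j Bool.≟ inside)
        ... | yes all = contradiction (trans (sym (intersection-inside ps j all)) j∉) λ ()
        ... | no ¬all =
          let i , i∉ = Fin.¬∀⟶∃¬ (suc r) _ (λ i → lookup (ps i) j Bool.≟ inside) ¬all
          in trans (coordinates-unique indep _ _ (λ t → trans (sym (proj₂ (proj₂ (coords zero)) t)) (proj₂ (proj₂ (coords i)) t)) j)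
                   (proj₁ (proj₂ (coords i)) j (Bool.¬-not i∉))
      from′ : Coordinate T (intersection ps) x → ⋂ F A x
      from′ (c , van , x≡) i = Equivalence.from (A⇔ i x) (c , (λ j j∉ → van j (intersection-outside ps j i j∉)) , x≡)

-- Counting bases

module Counting {q : ℕ} (F : FiniteField q) where
  open FiniteField F
  open LinearAlgebra F

  vectors : ∀ n → List (Vec Carrier n)
  vectors = vecs scalars

  tuples : ∀ n m → List (Vec (Vec Carrier n) m)
  tuples n = vecs (vectors n)

  vectors-complete : ∀ {n} (x : Vec Carrier n) → x ∈ vectors n
  vectors-complete = vecs-complete scalars-complete

  vectors-unique : ∀ n → Unique (vectors n)
  vectors-unique = vecs-unique scalars-unique

  length-vectors : ∀ n → length (vectors n) ≡ q ^ n
  length-vectors n = trans (length-vecs scalars n) (cong (_^ n) (List.length-tabulate _))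

  length-tuples : ∀ n m → length (tuples n m) ≡ (q ^ n) ^ m
  length-tuples n m = trans (length-vecs (vectors n) m) (cong (_^ m) (length-vectors n))

  module _ {n m} (v : Fin m → Vect F n) where

    combine : Vec Carrier m → Vec Carrier n
    combine c = tabulate (lincomb F (lookup c) v)

    span-count-≤ : ∑ (vectors n) (λ x → ⟦ inSpan? v (lookup x) ⟧) ≤ q ^ m
    span-count-≤ = ≤-trans
      (count-image-≤ (Vec.≡-dec _≟_) (vectors-unique n) (λ x → inSpan? v (lookup x)) combine covered)
      (≤-reflexive (length-vectors m))
      where
      covered : ∀ x → InSpan F v (lookup x) → ∃ λ c → c ∈ vectors m × x ≡ combine c
      covered x (c , x≡) = tabulate c , vectors-complete _ ,
        trans (sym (Vec.tabulate∘lookup x))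
              (Vec.tabulate-cong λ t → trans (x≡ t) (lincomb-cong (λ j → sym (Vec.lookup∘tabulate c j)) t))

    span-count-≥ : LinIndep F v → q ^ m ≤ ∑ (vectors n) (λ x → ⟦ inSpan? v (lookup x) ⟧)
    span-count-≥ indep = ≤-trans (≤-reflexive (sym (length-vectors m)))
      (count-image-≥ (Vec.≡-dec _≟_) (vectors-unique n) (λ x → inSpan? v (lookup x)) combine
        (vectors-unique m) (λ _ → vectors-complete _) (λ c → lookup c , Vec.lookup∘tabulate _) combine-injective)
      where
      combine-injective : ∀ c c′ → combine c ≡ combine c′ → c ≡ c′
      combine-injective c c′ eq = trans (sym (Vec.tabulate∘lookup c)) (trans
        (Vec.tabulate-cong (coordinates-unique indep (lookup c) (lookup c′) λ t →
          trans (sym (Vec.lookup∘tabulate _ t)) (trans (cong (flip lookup t) eq) (Vec.lookup∘tabulate _ t))))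
        (Vec.tabulate∘lookup c′))

  -- After `m` vectors are chosen, at most `q ^ m` vectors lie in their span, so at least
  -- `s ∸ q ^ m` vectors satisfying `P` may come next.
  indepIn-count : ∀ {n} {P : Vec Carrier n → Set} (P? : Decidable P) {s} → s ≤ ∑ (vectors n) (λ x → ⟦ P? x ⟧) →
    ∀ m → prodUpTo m (λ i → s ∸ q ^ i) ≤ ∑ (tuples n m) (λ T → ⟦ indepIn? P? T ⟧)
  indepIn-count P? s≤ zero = ≤-refl
  indepIn-count {n} P? {s} s≤ (suc m) = begin
    prodUpTo m (λ i → s ∸ q ^ i) * (s ∸ q ^ m)
      ≤⟨ *-monoˡ-≤ (s ∸ q ^ m) (indepIn-count P? s≤ m) ⟩
    ∑ (tuples n m) (λ T → ⟦ indepIn? P? T ⟧) * (s ∸ q ^ m)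
      ≡⟨ ∑-*ʳ (tuples n m) _ (s ∸ q ^ m) ⟨
    ∑ (tuples n m) (λ T → ⟦ indepIn? P? T ⟧ * (s ∸ q ^ m))
      ≤⟨ ∑-mono (tuples n m) extensions ⟩
    ∑ (tuples n m) (λ T → ∑ (vectors n) λ x → ⟦ indepIn? P? (x ∷ T) ⟧)
      ≡⟨ ∑-vecs (vectors n) m _ ⟨
    ∑ (tuples n (suc m)) (λ T → ⟦ indepIn? P? T ⟧) ∎
    where
    open ≤-Reasoning
    new? = λ T x → P? x ×-dec ¬? (inSpan? (family {m = m} T) (lookup x))
    old-or-new : ∀ T x → ⟦ P? x ⟧ ≤ ⟦ inSpan? (family {m = m} T) (lookup x) ⟧ + ⟦ new? T x ⟧
    old-or-new T x with P? x | inSpan? (family T) (lookup x)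
    ... | yes _ | yes _ = s≤s z≤n
    ... | yes _ | no  _ = ≤-refl
    ... | no  _ | _     = z≤n
    new-count : ∀ T → s ∸ q ^ m ≤ ∑ (vectors n) (λ x → ⟦ new? T x ⟧)
    new-count T = m≤n+o⇒m∸n≤o _ _ (begin
      s                                                   ≤⟨ s≤ ⟩
      ∑ (vectors n) (λ x → ⟦ P? x ⟧)                      ≤⟨ ∑-mono (vectors n) (old-or-new T) ⟩
      ∑ (vectors n) (λ x → ⟦ inSpan? (family T) (lookup x) ⟧ + ⟦ new? T x ⟧)
                                                          ≡⟨ ∑-+ (vectors n) _ _ ⟩
      _ + ∑ (vectors n) (λ x → ⟦ new? T x ⟧)              ≤⟨ +-monoˡ-≤ _ (span-count-≤ (family T)) ⟩
      q ^ m + ∑ (vectors n) (λ x → ⟦ new? T x ⟧)          ∎)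
    extensions : ∀ T → ⟦ indepIn? P? T ⟧ * (s ∸ q ^ m) ≤ ∑ (vectors n) λ x → ⟦ indepIn? P? (x ∷ T) ⟧
    extensions T = begin
      ⟦ indepIn? P? T ⟧ * (s ∸ q ^ m)                             ≤⟨ *-monoʳ-≤ ⟦ indepIn? P? T ⟧ (new-count T) ⟩
      ⟦ indepIn? P? T ⟧ * ∑ (vectors n) (λ x → ⟦ new? T x ⟧)      ≡⟨ *-comm ⟦ indepIn? P? T ⟧ _ ⟩
      ∑ (vectors n) (λ x → ⟦ new? T x ⟧) * ⟦ indepIn? P? T ⟧      ≡⟨ ∑-*ʳ (vectors n) _ ⟦ indepIn? P? T ⟧ ⟨
      ∑ (vectors n) (λ x → ⟦ new? T x ⟧ * ⟦ indepIn? P? T ⟧)      ≡⟨ ∑-cong (vectors n) (λ x → ⟦⟧-× (new? T x) (indepIn? P? T)) ⟩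
      ∑ (vectors n) (λ x → ⟦ indepIn? P? (x ∷ T) ⟧)               ∎

  -- Counting replaces the exchange lemma: the span of `T` has at least `q ^ m` elements and lies in
  -- the span of `v`, which has at most `q ^ m`, so there is no room for a further `x`.
  basis-spans : ∀ {n m} {v : Fin m → Vect F n} (T : Vec (Vec Carrier n) m) →
    IndepIn (InSpan F v ∘ lookup) T → ∀ x → InSpan F v x ⇔ InSpan F (family T) x
  basis-spans {n} {m} {v} T indep x = mk⇔ to′ (span-trans T⊆)
    where
    open ≤-Reasoning
    T⊆ = indepIn⇒∈ T indep
    to′ : InSpan F v x → InSpan F (family T) x
    to′ x∈v = decidable-stable (inSpan? (family T) x) λ x∉T → <-irrefl refl (begin-strict
      q ^ m
        ≤⟨ span-count-≥ (family T) (indepIn⇒linIndep T indep) ⟩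
      ∑ (vectors n) (λ y → ⟦ inSpan? (family T) (lookup y) ⟧)
        <⟨ m<m+n _ (≤-trans (⟦⟧-true (x′ ≟ᵛ x′) refl) (∑-term (λ y → ⟦ y ≟ᵛ x′ ⟧) (vectors-complete x′))) ⟩
      ∑ (vectors n) (λ y → ⟦ inSpan? (family T) (lookup y) ⟧) + ∑ (vectors n) (λ y → ⟦ y ≟ᵛ x′ ⟧)
        ≡⟨ ∑-+ (vectors n) _ _ ⟨
      ∑ (vectors n) (λ y → ⟦ inSpan? (family T) (lookup y) ⟧ + ⟦ y ≟ᵛ x′ ⟧)
        ≤⟨ ∑-mono (vectors n) (enlarge x∉T) ⟩
      ∑ (vectors n) (λ y → ⟦ inSpan? v (lookup y) ⟧)
        ≤⟨ span-count-≤ v ⟩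
      q ^ m ∎)
      where
      _≟ᵛ_ = Vec.≡-dec {n = n} _≟_
      x′ = tabulate x
      enlarge : ¬ InSpan F (family T) x → ∀ y →
        ⟦ inSpan? (family T) (lookup y) ⟧ + ⟦ y ≟ᵛ x′ ⟧ ≤ ⟦ inSpan? v (lookup y) ⟧
      enlarge x∉T y with inSpan? (family T) (lookup y) | y ≟ᵛ x′
      ... | yes y∈T | yes refl = contradiction (span-resp (Vec.lookup∘tabulate x) y∈T) x∉T
      ... | yes y∈T | no  _    = ⟦⟧-true (inSpan? v (lookup y)) (span-trans T⊆ y∈T)
      ... | no  _   | yes refl = ⟦⟧-true (inSpan? v (lookup y)) (span-resp (sym ∘ Vec.lookup∘tabulate x) x∈v)
      ... | no  _   | no  _    = z≤n

  module Bases {n k M} (V : Fin M → VSet F n) (V-dim : ∀ i → HasDim F (V i) k)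
               (V-distinct : ∀ i j → ¬ (i ≡ j) → ¬ SameSet F (V i) (V j)) where
    open ≤-Reasoning

    -- `V i` is an arbitrary predicate; the basis supplied by `V-dim` gives it a span that `inSpan?`
    -- can decide.
    Basis : ∀ {m} → Fin M → Vec (Vec Carrier n) m → Set
    Basis i = IndepIn (InSpan F (proj₁ (V-dim i)) ∘ lookup)

    basis? : ∀ {m} i (T : Vec (Vec Carrier n) m) → Dec (Basis i T)
    basis? i = indepIn? λ x → inSpan? (proj₁ (V-dim i)) (lookup x)

    Good : ∀ {m} → Vec (Vec Carrier n) m → Set
    Good T = ∃ λ i → Basis i T

    good? : ∀ {m} (T : Vec (Vec Carrier n) m) → Dec (Good T)
    good? T = Fin.any? λ i → basis? i T

    -- The length is tied to `k` by an equation because a selected subtuple has length `∣ p ∣`,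
    -- which equals `k` only propositionally.
    basis⇔ : ∀ {m} → m ≡ k → ∀ {i} {T : Vec (Vec Carrier n) m} → Basis i T → ∀ x → V i x ⇔ InSpan F (family T) x
    basis⇔ refl {i} {T} basis x = ⇔-trans (proj₂ (proj₂ (V-dim i)) x) (basis-spans T basis x)

    basis-unique : ∀ {T : Vec (Vec Carrier n) k} i j → Basis i T → Basis j T → i ≡ j
    basis-unique i j Bi Bj = decidable-stable (i Fin.≟ j) λ i≢j →
      V-distinct i j i≢j λ x → ⇔-trans (basis⇔ refl Bi x) (⇔-sym (basis⇔ refl Bj x))

    -- No tuple is counted twice: a tuple that is a basis of two members would make them equal as
    -- sets.
    good-count : M * prodUpTo k (λ i → q ^ k ∸ q ^ i) ≤ ∑ (tuples n k) (λ T → ⟦ good? T ⟧)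
    good-count = begin
      M * g                                                         ≡⟨ cong (_* g) (List.length-tabulate {n = M} id) ⟨
      length (allFin M) * g                                         ≡⟨ ∑-const (allFin M) g ⟨
      ∑ (allFin M) (λ _ → g)                                        ≤⟨ ∑-mono (allFin M) (λ i → indepIn-count _
                                                                         (span-count-≥ _ (proj₁ (proj₂ (V-dim i)))) k) ⟩
      ∑ (allFin M) (λ i → ∑ (tuples n k) λ T → ⟦ basis? i T ⟧)      ≡⟨ ∑-swap (allFin M) (tuples n k) _ ⟩
      ∑ (tuples n k) (λ T → ∑ (allFin M) λ i → ⟦ basis? i T ⟧)      ≤⟨ ∑-mono (tuples n k) (λ T → ∑-∃! (Unique.allFin⁺ M)
                                                                         (λ i → basis? i T) (good? T) basis-unique λ i B → i , B) ⟩
      ∑ (tuples n k) (λ T → ⟦ good? T ⟧)                            ∎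
      where g = prodUpTo k λ i → q ^ k ∸ q ^ i

    Independent : ∀ {m} → Vec (Vec Carrier n) m → Set
    Independent = IndepIn λ _ → ⊤

    independent? : ∀ {m} (T : Vec (Vec Carrier n) m) → Dec (Independent T)
    independent? = indepIn? λ _ → yes tt

    independent-count : ∀ m → prodUpTo m (λ i → q ^ n ∸ q ^ i) ≤ ∑ (tuples n m) (λ T → ⟦ independent? T ⟧)
    independent-count = indepIn-count _ (≤-reflexive (sym (trans (∑-const (vectors n) 1) (trans (*-identityʳ _) (length-vectors n)))))

    bad good dependent : ℕ → ℕ
    bad       m = ∑ (tuples n m) λ T → ⟦ ¬? (good? T) ⟧
    good      m = ∑ (tuples n m) λ T → ⟦ good? T ⟧
    dependent m = ∑ (tuples n m) λ T → ⟦ ¬? (independent? T) ⟧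

    complement-count : ∀ {m} {P : Vec (Vec Carrier n) m → Set} (P? : Decidable P) →
      ∑ (tuples n m) (λ T → ⟦ ¬? (P? T) ⟧) + ∑ (tuples n m) (λ T → ⟦ P? T ⟧) ≡ (q ^ n) ^ m
    complement-count {m} P? = begin-equality
      ∑ (tuples n m) (λ T → ⟦ ¬? (P? T) ⟧) + ∑ (tuples n m) (λ T → ⟦ P? T ⟧)    ≡⟨ ∑-+ (tuples n m) _ _ ⟨
      ∑ (tuples n m) (λ T → ⟦ ¬? (P? T) ⟧ + ⟦ P? T ⟧)                           ≡⟨ ∑-cong (tuples n m) (λ T → ⟦⟧-¬ (P? T)) ⟩
      ∑ (tuples n m) (λ T → 1)                                                  ≡⟨ ∑-const (tuples n m) 1 ⟩
      length (tuples n m) * 1                                                   ≡⟨ trans (*-identityʳ _) (length-tuples n m) ⟩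
      (q ^ n) ^ m                                                               ∎

    union-bound : ∀ {m r c} → 0 < q ^ n → m ≡ r + k → (p : Fin c → Subset m) → (∀ j → ∣ p j ∣ ≡ k) →
      ¬ ((q ^ n) ^ m ≤ dependent m + c * ((q ^ n) ^ r * bad k)) →
      ∃ λ T → Independent T × ∀ j → Good (select (p j) T)
    union-bound {m} {r} {c} Q>0 m≡r+k p ∣p∣≡k uncovered = decidable-stable
      -- Search through the finite list of tuples makes the conclusion decidable, so refuting its
      -- negation suffices.
      (map′ (λ found → Any.satisfied found) (λ (T , ok) → lose (vecs-complete vectors-complete T) ok)
        (Any.any? (λ T → independent? T ×-dec Fin.all? λ j → good? (select (p j) T)) (tuples n m)))
      λ none → uncovered (begin
        (q ^ n) ^ m
          ≡⟨ length-tuples n m ⟨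
        length (tuples n m)
          ≡⟨ trans (∑-const (tuples n m) 1) (*-identityʳ _) ⟨
        ∑ (tuples n m) (λ T → 1)
          ≤⟨ ∑-mono (tuples n m) (failure none) ⟩
        ∑ (tuples n m) (λ T → ⟦ ¬? (independent? T) ⟧ + ∑ (allFin c) λ j → ⟦ ¬? (good? (select (p j) T)) ⟧)
          ≡⟨ ∑-+ (tuples n m) _ _ ⟩
        dependent m + ∑ (tuples n m) (λ T → ∑ (allFin c) λ j → ⟦ ¬? (good? (select (p j) T)) ⟧)
          ≡⟨ cong (dependent m +_) (∑-swap (tuples n m) (allFin c) _) ⟩
        dependent m + ∑ (allFin c) (λ j → ∑ (tuples n m) λ T → ⟦ ¬? (good? (select (p j) T)) ⟧)
          ≡⟨ cong (dependent m +_) (trans (∑-cong (allFin c) marginal) (∑-const (allFin c) _)) ⟩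
        dependent m + length (allFin c) * ((q ^ n) ^ r * bad k)
          ≡⟨ cong (λ l → dependent m + l * ((q ^ n) ^ r * bad k)) (List.length-tabulate {n = c} id) ⟩
        dependent m + c * ((q ^ n) ^ r * bad k) ∎)
      where
      failure : ¬ (∃ λ T → Independent T × ∀ j → Good (select (p j) T)) → ∀ T →
        1 ≤ ⟦ ¬? (independent? T) ⟧ + ∑ (allFin c) λ j → ⟦ ¬? (good? (select (p j) T)) ⟧
      failure none T with independent? T
      ... | no  _     = s≤s z≤n
      ... | yes indep =
        let j , ¬good = Fin.¬∀⟶∃¬ c _ (λ j → good? (select (p j) T)) λ all → none (T , indep , all)
        in ≤-trans (⟦⟧-true (¬? (good? (select (p j) T))) ¬good)
                   (∑-term (λ j → ⟦ ¬? (good? (select (p j) T)) ⟧) (∈-allFin j))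
      marginal : ∀ j → ∑ (tuples n m) (λ T → ⟦ ¬? (good? (select (p j) T)) ⟧) ≡ (q ^ n) ^ r * bad k
      marginal j = *-cancelˡ-≡ _ _ ((q ^ n) ^ k) (begin-equality
        (q ^ n) ^ k * ∑ (tuples n m) (λ T → ⟦ ¬? (good? (select (p j) T)) ⟧)
          ≡⟨ cong₂ (λ L l → L ^ l * ∑ (tuples n m) (λ T → ⟦ ¬? (good? (select (p j) T)) ⟧)) (length-vectors n) (∣p∣≡k j) ⟨
        length (vectors n) ^ ∣ p j ∣ * ∑ (tuples n m) (λ T → ⟦ ¬? (good? (select (p j) T)) ⟧)
          ≡⟨ ∑-select (vectors n) (p j) (λ U → ⟦ ¬? (good? U) ⟧) ⟩
        length (vectors n) ^ m * bad ∣ p j ∣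
          ≡⟨ cong₂ (λ L l → L ^ m * bad l) (length-vectors n) (∣p∣≡k j) ⟩
        (q ^ n) ^ m * bad k
          ≡⟨ cong (λ l → (q ^ n) ^ l * bad k) (trans m≡r+k (+-comm r k)) ⟩
        (q ^ n) ^ (k + r) * bad k
          ≡⟨ cong (_* bad k) (^-distribˡ-+-* (q ^ n) k r) ⟩
        (q ^ n) ^ k * (q ^ n) ^ r * bad k
          ≡⟨ *-assoc ((q ^ n) ^ k) _ _ ⟩
        (q ^ n) ^ k * ((q ^ n) ^ r * bad k) ∎)
        where
        instance
          _ = >-nonZero Q>0
          _ = m^n≢0 (q ^ n) k

-- A simplex cluster of coordinate subspaces

∣++∣ : ∀ {m n} (p : Subset m) (r : Subset n) → ∣ p ++ᵛ r ∣ ≡ ∣ p ∣ + ∣ r ∣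
∣++∣ []            r = refl
∣++∣ (inside  ∷ p) r = cong suc (∣++∣ p r)
∣++∣ (outside ∷ p) r = ∣++∣ p r

∁⁅⁆-self : ∀ {n} (i : Fin n) → lookup (∁ ⁅ i ⁆) i ≡ outside
∁⁅⁆-self zero    = refl
∁⁅⁆-self (suc i) = ∁⁅⁆-self i

∁⁅⁆-other : ∀ {n} (i j : Fin n) → i ≢ j → lookup (∁ ⁅ i ⁆) j ≡ inside
∁⁅⁆-other zero    zero    i≢j = contradiction refl i≢j
∁⁅⁆-other zero    (suc j) i≢j = trans (Vec.lookup-map j _ empty) (cong not (Vec.lookup-replicate j outside))
∁⁅⁆-other (suc i) zero    i≢j = refl
∁⁅⁆-other (suc i) (suc j) i≢j = ∁⁅⁆-other i j (i≢j ∘ cong suc)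

∣p∣≡0 : ∀ {n} (p : Subset n) → (∀ j → lookup p j ≡ outside) → ∣ p ∣ ≡ 0
∣p∣≡0 []            out = refl
∣p∣≡0 (inside  ∷ p) out = contradiction (out zero) λ ()
∣p∣≡0 (outside ∷ p) out = ∣p∣≡0 p (out ∘ suc)

∣p∣>0 : ∀ {n} (p : Subset n) j → lookup p j ≡ inside → 0 < ∣ p ∣
∣p∣>0 (inside  ∷ p) j       _   = s≤s z≤n
∣p∣>0 (outside ∷ p) (suc j) j∈p = ∣p∣>0 p j j∈p

-- If every value were hit, choosing preimages would inject `Fin (suc d)` into `Fin d`.
missedValue : ∀ {d} (f : Fin d → Fin (suc d)) → ∃ λ j → ∀ i → f i ≢ j
missedValue {d} f = decidable-stable (Fin.any? λ j → Fin.all? λ i → ¬? (f i Fin.≟ j)) λ none →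
  <⇒≱ (n<1+n d) (Fin.injective⇒≤ (section-injective (hit none)))
  where
  hit : ¬ (∃ λ j → ∀ i → f i ≢ j) → ∀ j → ∃ λ i → f i ≡ j
  hit none j = decidable-stable (Fin.any? λ i → f i Fin.≟ j) λ unhit → none (j , λ i eq → unhit (i , eq))
  section-injective : (h : ∀ j → ∃ λ i → f i ≡ j) → Injective _≡_ _≡_ (proj₁ ∘ h)
  section-injective h {x} {y} eq = trans (sym (proj₂ (h x))) (trans (cong f eq) (proj₂ (h y)))

-- Coordinate patterns of a simplex cluster of 1 + d spaces, d = suc d′, on 1 + d + e + e points: the
-- first 1 + d points form the simplex (pattern j omits point j), the two blocks of e points pad the
-- patterns to size d + e, and only pattern 0 uses the first block, so no padding point is common to all.
module Patterns (d′ e : ℕ) where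

  d points : ℕ
  d = suc d′
  points = suc d + (e + e)

  left right : Fin (suc d) → Subset e
  left  zero    = full
  left  (suc _) = empty
  right zero    = empty
  right (suc _) = full

  slots : Fin (suc d) → Subset points
  slots j = ∁ ⁅ j ⁆ ++ᵛ (left j ++ᵛ right j)

  slots-size : ∀ j → ∣ slots j ∣ ≡ d + e
  slots-size j = begin
    ∣ slots j ∣                                 ≡⟨ trans (∣++∣ (∁ ⁅ j ⁆) _) (cong (∣ ∁ ⁅ j ⁆ ∣ +_) (∣++∣ (left j) (right j))) ⟩
    ∣ ∁ ⁅ j ⁆ ∣ + (∣ left j ∣ + ∣ right j ∣)    ≡⟨ cong₂ _+_ (trans (∣∁p∣≡n∸∣p∣ ⁅ j ⁆) (cong (suc d ∸_) (∣⁅x⁆∣≡1 j))) (padding j) ⟩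
    d + e                                       ∎
    where
    open ≡-Reasoning
    padding : ∀ j → ∣ left j ∣ + ∣ right j ∣ ≡ e
    padding zero    = trans (cong₂ _+_ (∣⊤∣≡n e) (∣⊥∣≡0 e)) (+-identityʳ e)
    padding (suc j) = cong₂ _+_ (∣⊥∣≡0 e) (∣⊤∣≡n e)

  apex : Fin (suc d) → Fin points
  apex j = j ↑ˡ (e + e)

  apex-outside : ∀ j → lookup (slots j) (apex j) ≡ outside
  apex-outside j = trans (Vec.lookup-++ˡ (∁ ⁅ j ⁆) _ j) (∁⁅⁆-self j)

  apex-inside : ∀ i j → i ≢ j → lookup (slots i) (apex j) ≡ inside
  apex-inside i j i≢j = trans (Vec.lookup-++ˡ (∁ ⁅ i ⁆) _ j) (∁⁅⁆-other i j i≢j)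

  -- Off the simplex points all patterns with positive index agree, so patterns 0 and 1 alone show
  -- that a padding point is omitted by some pattern and used by some pattern.
  data Position (s : Fin points) : Set where
    simplex : ∀ i → (∀ j → lookup (slots j) s ≡ lookup (∁ ⁅ j ⁆) i) → Position s
    block₁  : lookup (slots zero) s ≡ inside → lookup (slots (suc zero)) s ≡ outside → Position s
    block₂  : lookup (slots zero) s ≡ outside → lookup (slots (suc zero)) s ≡ inside → Position s

  position : ∀ s → Position s
  position s with splitAt (suc d) s | (λ j → Vec.lookup-splitAt (suc d) (∁ ⁅ j ⁆) (left j ++ᵛ right j) s)
  ... | inj₁ i  | eq = simplex i eq
  ... | inj₂ s′ | eq with splitAt e s′ | (λ j → Vec.lookup-splitAt e (left j) (right j) s′)
  ...   | inj₁ a | eq′ = block₁ (trans (eq zero) (trans (eq′ zero) (Vec.lookup-replicate a inside)))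
                                (trans (eq (suc zero)) (trans (eq′ (suc zero)) (Vec.lookup-replicate a outside)))
  ...   | inj₂ b | eq′ = block₂ (trans (eq zero) (trans (eq′ zero) (Vec.lookup-replicate b outside)))
                                (trans (eq (suc zero)) (trans (eq′ (suc zero)) (Vec.lookup-replicate b inside)))

  slots-outside : ∀ s → ∃ λ j → lookup (slots j) s ≡ outside
  slots-outside s with position s
  ... | simplex i eq  = i , trans (eq i) (∁⁅⁆-self i)
  ... | block₁ _ out  = suc zero , out
  ... | block₂ out _  = zero , out

  slots-inside : ∀ s → ∃ λ j → lookup (slots j) s ≡ inside
  slots-inside s with position s
  ... | simplex zero    eq = suc zero , trans (eq (suc zero)) refl
  ... | simplex (suc i) eq = zero , trans (eq zero) (∁⁅⁆-other zero (suc i) λ ())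
  ... | block₁ ins _       = zero , ins
  ... | block₂ _ ins       = suc zero , ins

  module _ {q} (F : FiniteField q) {n} (T : Vec (Vec (FiniteField.Carrier F) n) points)
           (indep : LinIndep F (LinearAlgebra.family F T)) (A : Fin (suc d) → VSet F n)
           (A⇔ : ∀ j x → A j x ⇔ LinearAlgebra.Coordinate F T (slots j) x) where
    open LinearAlgebra F

    ⋂-trivial : HasDim F (⋂ F A) 0
    ⋂-trivial = subst (HasDim F (⋂ F A)) (∣p∣≡0 (intersection slots) none)
      (coordinate-dim T indep (intersection slots) (coordinate-⋂ T indep A slots A⇔))
      where
      none : ∀ s → lookup (intersection slots) s ≡ outside
      none s = let j , s∉ = slots-outside s in intersection-outside slots s j s∉

    -- Some `j` is not among the chosen indices, and `apex j` belongs to every pattern except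
    -- pattern `j`.
    simplex-⋂ : ∀ (f : Fin d → Fin (suc d)) → ∃ λ m → 0 < m × HasDim F (⋂ F (A ∘ f)) m
    simplex-⋂ f = let j , f≢j = missedValue f in
      ∣ intersection (slots ∘ f) ∣ ,
      ∣p∣>0 _ (apex j) (intersection-inside (slots ∘ f) (apex j) λ i → apex-inside (f i) j (f≢j i)) ,
      coordinate-dim T indep (intersection (slots ∘ f)) (coordinate-⋂ T indep (A ∘ f) (slots ∘ f) (A⇔ ∘ f))

    spanUnion-dim : HasDim F (SpanUnion F A) points
    spanUnion-dim = family T , indep , λ x → mk⇔
      (λ (m , c , v , v∈A , x≡) → span-resp {v = family T} (sym ∘ x≡) (span-lincomb {v = family T} v
        (λ j → let i , vⱼ∈Aᵢ = v∈A j
                   c′ , _ , v≡ = Equivalence.to (A⇔ i (v j)) vⱼ∈Aᵢ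
               in c′ , v≡) c))
      (λ (c , x≡) → points , c , family T ,
        (λ s → let j , s∈ = slots-inside s in j , Equivalence.from (A⇔ j _) (coordinate-member T indep (slots j) s s∈)) , x≡)

    simplexCluster : ∀ {k} → points ≤ 2 * k → IsSimplexCluster F k d A
    simplexCluster small = (⋂-trivial , λ f _ → simplex-⋂ f) , (⋂-trivial , points , small , spanUnion-dim)

    -- The vector at `apex j` separates the two spaces. This makes the choice of members injective
    -- in the end.
    distinct : ∀ i j → i ≢ j → ¬ SameSet F (A i) (A j)
    distinct i j i≢j same = coordinate-nonmember T indep (slots j) (apex j) (apex-outside j)
      (Equivalence.to (A⇔ j _) (Equivalence.to (same _)
        (Equivalence.from (A⇔ i _) (coordinate-member T indep (slots i) (apex j) (apex-inside i j i≢j)))))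

-- Choice of parameters and conclusion

n<m^n : ∀ {m} n → 2 ≤ m → n < m ^ n
n<m^n     zero    2≤m = ≤-refl
n<m^n {m} (suc n) 2≤m = begin-strict
  suc n            ≤⟨ n<m^n n 2≤m ⟩
  m ^ n            <⟨ m<m+n (m ^ n) (≤-trans (s≤s z≤n) (n<m^n n 2≤m)) ⟩
  m ^ n + m ^ n    ≡⟨ cong (m ^ n +_) (+-identityʳ (m ^ n)) ⟨
  2 * m ^ n        ≤⟨ *-monoˡ-≤ (m ^ n) 2≤m ⟩
  m * m ^ n        ∎
  where open ≤-Reasoning

module Main (q l d′ : ℕ) (2≤q : 2 ≤ q) (d<k : 2 + d′ ≤ suc l) where
  open GaussianBinomial q 2≤q
  open ≤-Reasoning

  k e : ℕ
  k = suc l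
  e = k ∸ suc d′

  open Patterns d′ e

  d+e≡k : d + e ≡ k
  d+e≡k = m+[n∸m]≡n (<⇒≤ d<k)

  -- Each pattern has `k` points and leaves `suc e` free, which is the exponent `r` in the union
  -- bound.
  points≡ : points ≡ suc e + k
  points≡ = trans (rearrange d e) (cong (suc e +_) d+e≡k)
    where
    rearrange : ∀ d e → suc d + (e + e) ≡ suc e + (d + e)
    rearrange = solve-∀

  -- Since `d ≥ 1`, the `suc e` points outside a pattern number at most `d + e = k`.
  points≤2k : points ≤ 2 * k
  points≤2k = begin
    points            ≡⟨ points≡ ⟩
    suc e + k         ≤⟨ +-monoˡ-≤ k (≤-trans (+-monoˡ-≤ e (s≤s z≤n)) (≤-reflexive d+e≡k)) ⟩
    k + k             ≡⟨ cong (k +_) (+-identityʳ k) ⟨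
    2 * k             ∎

  -- `s` is the Weierstrass loss for independent tuples of `points` vectors, `t` the loss for the
  -- vectors of a basis after the first. Neither involves `n`, so `q ^ (n ∸ k)` outgrows
  -- `threshold`; `n ∸ k ≥ threshold` already suffices, as `q ^ x > x`.
  s t threshold : ℕ
  s = sumUpTo points (q ^_)
  t = sumUpTo l (λ i → q ^ suc i)
  threshold = s + suc d * t

  module _ (F : FiniteField q) (n′ : ℕ) (n-large : threshold + k ≤ suc n′) {M : ℕ} (V : Fin M → VSet F (suc n′))
           (V-dim : ∀ i → HasDim F (V i) k)
           (V-distinct : ∀ i j → ¬ (i ≡ j) → ¬ SameSet F (V i) (V j)) where
    open LinearAlgebra F
    open Counting F
    open Bases V V-dim V-distinct

    n Q : ℕ
    n = suc n′
    Q = q ^ n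

    k≤n : k ≤ n
    k≤n = ≤-trans (m≤n+m k threshold) n-large

    Q>0 : 0 < Q
    Q>0 = m^n>0 q n

    Q≡KR : Q ≡ q ^ k * q ^ (n ∸ k)
    Q≡KR = trans (cong (q ^_) (sym (m+[n∸m]≡n k≤n))) (^-distribˡ-+-* q k (n ∸ k))

    R-large : threshold < q ^ (n ∸ k)
    R-large = ≤-<-trans (m+n≤o⇒m≤o∸n threshold n-large) (n<m^n (n ∸ k) 2≤q)

    module _ (M-large : q ^ (n ∸ k) * gauss q n′ l ≤ M) where

      bad-small : Q * bad k ≤ Q ^ k * (q ^ (n ∸ k) + t)
      bad-small = complement-upper′ Q (λ i → q ^ suc i) l {K = q ^ k} Q≡KR (complement-count {m = k} good?) (begin
        (q ^ k ∸ 1) * q ^ (n ∸ k) * prodUpTo l (λ i → Q ∸ q ^ suc i)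
          ≡⟨ gauss-bases n′ l (≤-pred k≤n) ⟨
        q ^ (n ∸ k) * gauss q n′ l * prodUpTo k (λ i → q ^ k ∸ q ^ i)
          ≤⟨ *-monoˡ-≤ _ M-large ⟩
        M * prodUpTo k (λ i → q ^ k ∸ q ^ i)
          ≤⟨ good-count ⟩
        good k ∎)

      dependent-small : Q * dependent points ≤ Q ^ points * s
      dependent-small = complement-upper Q (q ^_) points (complement-count {m = points} independent?) (independent-count points)

      good-tuple : ∃ λ T → Independent T × ∀ j → Good (select (slots j) T)
      good-tuple = union-bound {r = suc e} Q>0 points≡ slots (λ j → trans (slots-size j) d+e≡k) λ covered →
        union-bound-fails Q (q ^ k) (q ^ (n ∸ k)) (suc d) (suc e) k s t (dependent points) (bad k) Q>0 Q≡KR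
          -- `d + 1 ≤ k < q ^ k` is why `d + 1` failures of probability about `q ^ (-k)` cannot
          -- cover everything.
          (≤-<-trans d<k (n<m^n k 2≤q)) R-large
          (subst (λ m → Q * dependent points ≤ Q ^ m * s) points≡ dependent-small) bad-small
          (subst (λ m → Q ^ m ≤ dependent points + suc d * (Q ^ suc e * bad k)) points≡ covered)

      simplexCluster-exists : ∃ λ (f : Fin (suc d) → Fin M) → Injective _≡_ _≡_ f × IsSimplexCluster F k d (V ∘ f)
      simplexCluster-exists = f , f-injective , simplexCluster F T T-indep (V ∘ f) V⇔ {k = k} points≤2k
        where
        T = proj₁ good-tuple
        T-indep = indepIn⇒linIndep T (proj₁ (proj₂ good-tuple))
        f = λ j → proj₁ (proj₂ (proj₂ good-tuple) j)
        V⇔ : ∀ j x → V (f j) x ⇔ Coordinate T (slots j) x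
        V⇔ j x = ⇔-trans (basis⇔ (trans (slots-size j) d+e≡k) (proj₂ (proj₂ (proj₂ good-tuple) j)) x)
                         (⇔-sym (coordinate⇔span T (slots j) x))
        f-injective : Injective _≡_ _≡_ f
        f-injective {i} {j} fi≡fj = decidable-stable (i Fin.≟ j) λ i≢j →
          distinct F T T-indep (V ∘ f) V⇔ i j i≢j (subst (λ v → SameSet F (V (f i)) (V v)) fi≡fj λ x → mk⇔ id id)

theorem4p3 : (q k d : ℕ) → IsPrimePower q → 3 ≤ suc d → suc d ≤ k →
    Σ ℕ λ N → (F : FiniteField q) → (n : ℕ) → N ≤ n →
    (M : ℕ) → (V : Fin M → VSet F n) →
    (∀ i → HasDim F (V i) k) →
    (∀ i j → ¬ (i ≡ j) → ¬ SameSet F (V i) (V j)) →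
    (∀ (f : Fin (suc d) → Fin M) → Injective _≡_ _≡_ f → ¬ IsSimplexCluster F k d (V ∘ f)) →
    (M < q ^ (n ∸ k) * gauss q (n ∸ 1) (k ∸ 1)) ×
    (q ^ (n ∸ k) * gauss q (n ∸ 1) (k ∸ 1) ≡ gauss q n k ∸ gauss q (n ∸ 1) k)
theorem4p3 q k       zero     _            (s≤s ()) _
theorem4p3 q (suc l) (suc d′) q-primePower 3≤1+d d<k = threshold + suc l , λ where
    -- The threshold includes `k ≥ 1`, so `n` is a successor and the predecessors in the bound
    -- compute.
    F zero     n-large → contradiction (≤-trans (m≤n+m (suc l) threshold) n-large) λ ()
    F (suc n′) n-large M V V-dim V-distinct no-cluster →
      ≰⇒> (λ M-large →
        let f , f-injective , cluster = simplexCluster-exists F n′ n-large V V-dim V-distinct M-large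
        in no-cluster f f-injective cluster) ,
      GaussianBinomial.gauss-pascal q 2≤q n′ l
  where
  2≤q = primePower⇒2≤ q-primePower
  open Main q l d′ 2≤q d<k
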